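{- For an irreducible, positive recurrent Markov chain $\{X_t\}$ with countable state space $\Sigma$ and transition probability matrix $P$, and for any $i\in\Sigma$ and $k\in\mathbb Z_+$, $$1-\frac{\mathbb E_i[\hat T_i^{(k)}]}{\mathbb E_i[T_i]}=\mathbb P_i\big(T_i>\theta^{(k)}\big)\,\Gamma_i(\theta^{(k)}),$$ where $$\Gamma_i(\theta)=\sum_{q\in\Sigma\setminus\{i\}}\mathbb P_i\left(X_\theta=q\mid T_i>\theta\right)(Z_{ii}-Z_{qi}).$$
   Context: $\mathbb P_i(\cdot)=\mathbb P(\cdot\mid X_0=i)$ and $\mathbb E_i[\cdot]=\mathbb E[\cdot\mid X_0=i]$; $T_i=\inf\{t\ge1:X_t=i\}$; $\pi$ is the unique stationary distribution; $\mathbb Z_+$ denotes the positive integers and $k$ is an iteration index. $\theta^{(k)}=2^k$ is the truncation threshold at iteration $k$, and $\hat T_i^{(k)}$ is the sample average of independent copies of $\min(T_i,\theta^{(k)})$ (chain started at $i$) collected at iteration $k$, so that $\mathbb E_i[\hat T_i^{(k)}]=\mathbb E_i[\min(T_i,\theta^{(k)})]$. $Z$ is the fundamental matrix, with entries $Z_{jl}=\sum_{t=0}^\infty(P^t_{jl}-\pi_l)$, where $P^t_{jl}$ is the $(j,l)$ entry of $P^t$.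
   Formalization: The series defining the entries Z_{ji} (for the given i and all states j) are assumed to converge; for a general irreducible positive recurrent chain, e.g. a periodic one, they need not, and Z is then undefined. -}

module Defs where

open import Algebra.Bundles using (CommutativeRing)
open import Data.Empty using (⊥-elim)
open import Data.Fin.Base using (Fin)
open import Data.List.Base using (List; map; foldr; upTo)
open import Data.List.Relation.Binary.Subset.Propositional using () renaming (_⊆_ to _⊆ₗ_)
open import Data.List.Relation.Unary.Unique.Propositional using (Unique)
open import Data.Nat.Base as ℕ using (ℕ; zero; suc)
open import Data.Product.Base using (_×_; _,_; ∃; ∃-syntax)
open import Data.Refinement.Base using (Refinement-syntax; value)
open import Data.Sum.Base using (_⊎_; inj₁; inj₂)
import Data.Vec.Functional as Vector
open import Level using (0ℓ)
open import Relation.Binary.Construct.Add.Supremum.Strict ℕ._<_ using (_<⁺_)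
import Relation.Binary.Construct.StrictToNonStrict as StrictToNonStrict
open import Relation.Binary.Core using (Rel)
open import Relation.Binary.Definitions using (tri<; tri≈; tri>)
open import Relation.Binary.PropositionalEquality.Core using (_≡_; _≢_)
open import Relation.Binary.Structures using (IsStrictTotalOrder)
open import Relation.Nullary.Construct.Add.Supremum using (_⁺; [_]; ⊤⁺)
open import Relation.Nullary.Decidable.Core using (Dec; yes; no)
open import Relation.Nullary.Negation.Core using (¬_)
open import Relation.Unary using (Pred; U; ∁; _∩_; _≐_; _⊥_; ⋃)

-- The real numbers, given by their characterisation as a Dedekind-complete
-- ordered field (unique up to isomorphism).  Trichotomy and completeness are
-- the classical ones; together they yield excluded middle (`lem` below).
record CompleteOrderedField : Set₁ where
  field
    commutativeRing : CommutativeRing 0ℓ 0ℓ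

  open CommutativeRing commutativeRing public

  infix 4 _<_
  infix 8 _⁻¹

  field
    _<_                : Rel Carrier 0ℓ
    isStrictTotalOrder : IsStrictTotalOrder _≈_ _<_
    0<1                : 0# < 1#
    +-monoˡ-<          : ∀ z {x y} → x < y → x + z < y + z
    *-pos              : ∀ {x y} → 0# < x → 0# < y → 0# < x * y
    _⁻¹                : Carrier → Carrier
    ⁻¹-inverseʳ        : ∀ x → ¬ (x ≈ 0#) → x * x ⁻¹ ≈ 1#
    -- Makes the inverse total; it only matters for conditioning on null events.
    ⁻¹-zero            : ∀ x → x ≈ 0# → x ⁻¹ ≈ 0#

  open StrictToNonStrict _≈_ _<_ public using (_≤_)

  -- The last conjunct is the approximation form of "s is the least upper bound".
  field
    complete : (E : Pred Carrier 0ℓ) → ∃ E → (∃[ b ] ∀ x → E x → x ≤ b) →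
               ∃[ s ] (∀ x → E x → x ≤ s) ×
                      (∀ y → y < s → ∃[ x ] E x × y < x)

module Theory ⦃ R : CompleteOrderedField ⦄ where

  open CompleteOrderedField R public renaming (Carrier to ℝ)
  private module < = IsStrictTotalOrder isStrictTotalOrder

  lem : (A : Set) → Dec A
  lem A = decide (complete E (0# , inj₁ refl) (1# , bounded))
    where
    E : Pred ℝ 0ℓ
    E x = x ≈ 0# ⊎ (A × x ≈ 1#)

    bounded : ∀ x → E x → x ≤ 1#
    bounded x (inj₁ x≈0)       = inj₁ (<.<-respˡ-≈ (sym x≈0) 0<1)
    bounded x (inj₂ (_ , x≈1)) = inj₂ x≈1

    positive : ∀ {s} → 1# ≤ s → 0# < s
    positive (inj₁ 1<s) = <.trans 0<1 1<s
    positive (inj₂ 1≈s) = <.<-respʳ-≈ 1≈s 0<1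

    witness : (∃[ x ] E x × 0# < x) → A
    witness (x , inj₁ x≈0 , 0<x)     = ⊥-elim (<.irrefl (sym x≈0) 0<x)
    witness (x , inj₂ (a , _) , 0<x) = a

    decide : (∃[ s ] (∀ x → E x → x ≤ s) × (∀ y → y < s → ∃[ x ] E x × y < x)) → Dec A
    decide (s , upper , approx) with <.compare 0# s
    ... | tri< 0<s _ _ = yes (witness (approx 0# 0<s))
    ... | tri≈ 0≮s _ _ = no λ a → 0≮s (positive (upper 1# (inj₂ (a , refl))))
    ... | tri> 0≮s _ _ = no λ a → 0≮s (positive (upper 1# (inj₂ (a , refl))))

  infixl 7 _÷_

  _÷_ : ℝ → ℝ → ℝ
  x ÷ y = x * y ⁻¹

  fromℕ : ℕ → ℝ
  fromℕ zero    = 0#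
  fromℕ (suc n) = 1# + fromℕ n

  indicator : Set → ℝ
  indicator A with lem A
  ... | yes _ = 1#
  ... | no  _ = 0#

  the : (ℝ → Set) → ℝ
  the Q with lem (∃ Q)
  ... | yes (s , _) = s
  ... | no  _       = 0#

  Close : ℝ → ℝ → ℝ → Set
  Close ε x y = (x - y < ε) × (y - x < ε)

  finiteSum : {I : Set} → (I → ℝ) → List I → ℝ
  finiteSum f is = foldr _+_ 0# (map f is)

  -- Unordered (equivalently, absolutely convergent) sums over an index set,
  -- finite subsets being represented by duplicate-free lists.
  HasSum : {I : Set} → (I → ℝ) → ℝ → Set
  HasSum {I} f s = ∀ ε → 0# < ε →
    ∃[ is ] Unique is ×
            (∀ (js : List I) → Unique js → is ⊆ₗ js → Close ε (finiteSum f js) s)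

  Summable : {I : Set} → (I → ℝ) → Set
  Summable f = ∃ (HasSum f)

  -- 0 when the sum does not exist.
  ∑ : {I : Set} → (I → ℝ) → ℝ
  ∑ f = the (HasSum f)

  -- Possibly conditionally convergent series  Σ_{t=0}^∞ a t.
  HasSeriesSum : (ℕ → ℝ) → ℝ → Set
  HasSeriesSum a s = ∀ ε → 0# < ε →
    ∃[ N ] ∀ n → N ℕ.≤ n → Close ε (finiteSum a (upTo n)) s

  SeriesConverges : (ℕ → ℝ) → Set
  SeriesConverges a = ∃ (HasSeriesSum a)

  -- 0 when the series diverges.
  ∑∞ : (ℕ → ℝ) → ℝ
  ∑∞ a = the (HasSeriesSum a)

  record SigmaAlgebra (Ω : Set) : Set₁ where
    field
      Measurable : Pred Ω 0ℓ → Set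
      resp       : ∀ {A B} → A ≐ B → Measurable A → Measurable B
      universe   : Measurable U
      complement : ∀ {A} → Measurable A → Measurable (∁ A)
      union      : (A : ℕ → Pred Ω 0ℓ) → (∀ n → Measurable (A n)) → Measurable (⋃ ℕ A)

  -- ℙ is a total function on subsets, constrained only on measurable ones.
  record ProbabilityMeasure {Ω : Set} (F : SigmaAlgebra Ω) : Set₁ where
    open SigmaAlgebra F
    field
      ℙ        : Pred Ω 0ℓ → ℝ
      ℙ-cong   : ∀ {A B} → Measurable A → A ≐ B → ℙ A ≈ ℙ B
      ℙ-nonneg : ∀ {A} → Measurable A → 0# ≤ ℙ A
      ℙ-total  : ℙ U ≈ 1#
      ℙ-union  : (A : ℕ → Pred Ω 0ℓ) → (∀ n → Measurable (A n)) →
                 (∀ m n → m ≢ n → A m ⊥ A n) →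
                 HasSeriesSum (λ n → ℙ (A n)) (ℙ (⋃ ℕ A))

    infix 5 ℙ[_∣_]
    ℙ[_∣_] : Pred Ω 0ℓ → Pred Ω 0ℓ → ℝ
    ℙ[ A ∣ B ] = ℙ (A ∩ B) ÷ ℙ B

    -- 𝔼[ f ∘ Y ] for a random variable Y with countably many values.
    𝔼 : {V : Set} → (V → ℝ) → (Ω → V) → ℝ
    𝔼 f Y = ∑ λ v → f v * ℙ (λ ω → Y ω ≡ v)

  record IndependentCopies {Ω : Set} {F : SigmaAlgebra Ω}
                           (μ : ProbabilityMeasure F) (Y : Ω → ℕ) : Set₁ where
    private module μ = ProbabilityMeasure μ
    field
      N           : ℕ
      N-positive  : 1 ℕ.≤ N
      Ω′          : Set
      F′          : SigmaAlgebra Ω′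
      μ′          : ProbabilityMeasure F′
    open SigmaAlgebra F′
    open ProbabilityMeasure μ′
    field
      copy        : Fin N → Ω′ → ℕ
      measurable  : ∀ s n → Measurable (λ ω → copy s ω ≡ n)
      same-law    : ∀ s n → ℙ (λ ω → copy s ω ≡ n) ≈ μ.ℙ (λ ω → Y ω ≡ n)
      independent : ∀ (v : Fin N → ℕ) →
        ℙ (λ ω → ∀ s → copy s ω ≡ v s) ≈
        Vector.foldr _*_ 1# (λ s → ℙ (λ ω → copy s ω ≡ v s))

    total : Ω′ → ℕ
    total ω = Vector.foldr ℕ._+_ 0 (λ s → copy s ω)

    -- Expectation of the sample average  total / N.
    𝔼average : ℝ
    𝔼average = 𝔼 (λ m → fromℕ m ÷ fromℕ N) total

  record IsStochastic {S : Set} (P : S → S → ℝ) : Set where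
    field
      nonneg  : ∀ j l → 0# ≤ P j l
      row-sum : ∀ j → HasSum (P j) 1#

  -- Matrix powers: power P t j l is the (j , l) entry of P^t.
  power : {S : Set} → (S → S → ℝ) → ℕ → S → S → ℝ
  power P zero    j l = indicator (j ≡ l)
  power P (suc t) j l = ∑ λ x → P j x * power P t x l

  Irreducible : {S : Set} → (S → S → ℝ) → Set
  Irreducible P = ∀ j l → ∃[ t ] 0# < power P t j l

  record IsStationary {S : Set} (P : S → S → ℝ) (π : S → ℝ) : Set where
    field
      nonneg     : ∀ j → 0# ≤ π j
      sum-one    : HasSum π 1#
      stationary : ∀ l → HasSum (λ j → π j * P j l) (π l)

  Z : {S : Set} → (S → S → ℝ) → (S → ℝ) → S → S → ℝ
  Z P π j l = ∑∞ λ t → power P t j l - π l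

  IsLeast : Pred ℕ 0ℓ → ℕ → Set
  IsLeast A n = A n × (∀ m → A m → n ℕ.≤ m)

  -- ⊤⁺ is the infimum of the empty set.
  inf : Pred ℕ 0ℓ → ℕ ⁺
  inf A with lem (∃ (IsLeast A))
  ... | yes (n , _) = [ n ]
  ... | no  _       = ⊤⁺

  truncate : ℕ → ℕ ⁺ → ℕ
  truncate θ [ n ] = n ℕ.⊓ θ
  truncate θ ⊤⁺    = θ

  -- A Markov chain with transition matrix P, together with its laws
  -- law i = ℙ( · ∣ X₀ = i) for every starting state i.
  record MarkovChain {S : Set} (P : S → S → ℝ) : Set₁ where
    field
      Ω          : Set
      F          : SigmaAlgebra Ω
      X          : ℕ → Ω → S
    open SigmaAlgebra F
    open ProbabilityMeasure using (ℙ; ℙ[_∣_])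
    field
      measurable : ∀ t x → Measurable (λ ω → X t ω ≡ x)
      law        : S → ProbabilityMeasure F
      initial    : ∀ i → ℙ (law i) (λ ω → X 0 ω ≡ i) ≈ 1#

    Follows : ℕ → (ℕ → S) → Pred Ω 0ℓ
    Follows t x ω = ∀ s → s ℕ.≤ t → X s ω ≡ x s

    field
      markov     : ∀ i t (x : ℕ → S) y → ¬ (ℙ (law i) (Follows t x) ≈ 0#) →
                   ℙ[_∣_] (law i) (λ ω → X (suc t) ω ≡ y) (Follows t x) ≈ P (x t) y

    T : S → Ω → ℕ ⁺
    T i ω = inf λ t → 1 ℕ.≤ t × X t ω ≡ i

    ReturnsAfter : S → ℕ → Pred Ω 0ℓ
    ReturnsAfter i θ ω = [ θ ] <⁺ T i ω

    𝔼T-term : S → ℕ → ℝ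
    𝔼T-term i n = fromℕ n * ℙ (law i) (λ ω → T i ω ≡ [ n ])

    PositiveRecurrent : Set
    PositiveRecurrent = ∀ i → ℙ (law i) (λ ω → T i ω ≡ ⊤⁺) ≈ 0# × Summable (𝔼T-term i)

    -- The mean return time; the value ⊤⁺ does not contribute under recurrence.
    𝔼T : S → ℝ
    𝔼T i = ∑ (𝔼T-term i)

    Γ-term : (S → ℝ) → (i : S) → ℕ → [ q ∈ S ∣ q ≢ i ] → ℝ
    Γ-term π i θ q =
      ℙ[_∣_] (law i) (λ ω → X θ ω ≡ value q) (ReturnsAfter i θ) * (Z P π i i - Z P π (value q) i)

    Γ : (S → ℝ) → S → ℕ → ℝ
    Γ π i θ = ∑ (Γ-term π i θ)

  open ProbabilityMeasure public using (ℙ)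
  open IndependentCopies public using (𝔼average)
  open MarkovChain public using (law; T; ReturnsAfter; PositiveRecurrent; 𝔼T; Γ-term; Γ)

open Theory ⦃ ... ⦄ public

{-# OPTIONS --safe #-}
module Submission where

-- Let u t = P^t(i , i), let g n l be the probability, from l, of avoiding i at the times 1, …, n, and
-- let C n l = Σ_{k≤n} u (n - k) * g k l.  Splitting the visits to i at the first one gives, for l ≢ i,
--   C n l = Σ_{t≤n} (P^t(i , i) - P^t(l , i)),   while   C n i = 1.
-- As u t tends to π i, C n l tends to π i * Σ_k g k l, so that π i * E_i[T_i] = 1 and, up to a weight
-- that vanishes when the mean hitting time is infinite, Z_ii - Z_li = π i * Σ_k g k l.  By the Markov
-- property Σ_l P_i(X_θ = l, T_i > θ) g k l = P_i(T_i > θ + k), and the sum over k of the right-hand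
-- side is E_i[T_i] - E_i[min(T_i, θ)].

open import Algebra.Bundles using (CommutativeRing)
import Algebra.Properties.AbelianGroup as AbelianGroupProperties
import Algebra.Properties.Monoid.Mult.TCOptimised as MonoidMult
import Algebra.Properties.Ring as RingProperties
import Algebra.Properties.Semiring.Mult.TCOptimised as SemiringMult
import Algebra.Solver.Ring as RingSolver
open import Algebra.Solver.Ring.AlmostCommutativeRing using (fromCommutativeRing; _-Raw-AlmostCommutative⟶_; Induced-equivalence)
open import Data.Bool.Base using (Bool; true; false)
open import Data.Empty using (⊥; ⊥-elim)
open import Data.Fin.Base as Fin using (Fin)
open import Data.Integer.Base as ℤ using (ℤ)
import Data.Integer.Properties as ℤ
import Data.Irrelevant as Irrelevant
open import Data.List.Base using (List; []; _∷_; _++_; map; upTo; applyUpTo; deduplicate)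
open import Data.List.Membership.Propositional using (_∈_)
open import Data.List.Membership.Propositional.Properties
  using (∈-++⁻; ∈-++⁺ˡ; ∈-++⁺ʳ; ∈-∃++; ∈-deduplicate⁺; ∈-map⁺; ∈-map⁻; ∈-upTo⁺)
open import Data.List.Relation.Binary.Subset.Propositional using (_⊆_)
import Data.List.Relation.Unary.All as All
open import Data.List.Relation.Unary.All.Properties using (All¬⇒¬Any)
open import Data.List.Relation.Unary.AllPairs using ([]; _∷_)
open import Data.List.Relation.Unary.Any using (here; there)
open import Data.List.Relation.Unary.Unique.DecPropositional.Properties using (deduplicate-!)
open import Data.List.Relation.Unary.Unique.Propositional using (Unique)
open import Data.List.Relation.Unary.Unique.Propositional.Properties using (map⁺; upTo⁺)
open import Data.Maybe.Base using (just; nothing)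
open import Data.Nat.Base as ℕ using (ℕ; zero; suc; z≤n)
open import Data.Nat.Induction using (<-rec)
import Data.Nat.Properties as ℕ
open import Data.Product.Base using (_×_; _,_; proj₁; proj₂; ∃; ∃-syntax)
open import Data.Refinement.Base as Refinement using (Refinement-syntax; value)
open import Data.Sign.Base as Sign using ()
open import Data.Sum.Base using (_⊎_; inj₁; inj₂)
open import Data.Unit.Base using (tt)
import Data.Vec.Functional as Vector
open import Defs using (CompleteOrderedField; module Theory)
open import Function.Base using (_∘_; id; case_of_)
open import Function.Bundles using (_↣_; mk↣; Injection)
open import Function.Construct.Identity using (↣-id)
open import Level using (0ℓ)
open import Relation.Binary.Bundles using (StrictTotalOrder)
open import Relation.Binary.Construct.Add.Supremum.Strict ℕ._<_ using (_<⁺_; [_]; [_]<⊤⁺)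
open import Relation.Binary.Definitions using (WeaklyDecidable; tri<; tri≈; tri>)
open import Relation.Binary.PropositionalEquality as ≡ using (_≡_; _≢_)
import Relation.Binary.Reasoning.Setoid as SetoidReasoning
import Relation.Binary.Reasoning.StrictPartialOrder as StrictReasoning
open import Relation.Nullary.Construct.Add.Supremum using (_⁺; [_]; ⊤⁺)
open import Relation.Nullary.Decidable.Core using (Dec; yes; no; recompute)
open import Relation.Nullary.Negation.Core using (¬_)
open import Relation.Unary using (Pred; U; ∁; _∩_; _≐_; ⋃)

-- The differences `Z_ii - Z_qi` come from conditionally convergent series and have no evident sign,
-- so the sum over `q` in Γ cannot be exchanged directly with the sums over time. The limit in time
-- is therefore taken for each `q` separately. What remains are sums of avoidance probabilities:
-- nonnegative terms, whose sums are suprema of finite sums, so that Tonelli applies. The mean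
-- hitting time of `i` from `q` is not known to be finite, but each of its terms, weighted by
-- `P_i(X_θ = q, T_i > θ)`, is at most a tail probability of `T_i`. Hence the weight is put inside
-- the series before the limit is taken. The limit of `u t` needs no ergodic theorem: the terms
-- `u t - π i` of the convergent series for `Z_ii` must tend to 0. Applied to `C n i = 1`, the same
-- limit gives Kac's formula. The threshold has to be at least 1, because at time 0 the chain sits
-- in the excluded state `i`. A null conditioning event is a case of its own, in which both sides
-- vanish.

-- Integer coefficients for a ring solver

module IntegerCoefficients {c ℓ} (A : CommutativeRing c ℓ) where
  open CommutativeRing A hiding (zero)
  open import Data.Integer.Base using (+_; -[1+_])
  open AbelianGroupProperties +-abelianGroup using (⁻¹-∙-comm; ⁻¹-involutive; ε⁻¹≈ε)
  open RingProperties ring using (-‿distribˡ-*; -‿distribʳ-*)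
  open MonoidMult +-monoid using (1+×; ×-homo-+) renaming (_×_ to _·_)
  open SemiringMult semiring using (×1-homo-*)
  open SetoidReasoning setoid

  ⟦_⟧ : ℤ → Carrier
  ⟦ + n ⟧      = n · 1#
  ⟦ -[1+ n ] ⟧ = - (suc n · 1#)

  private
    cancel : ∀ x y z → (x + y) - (x + z) ≈ y - z
    cancel x y z = begin
      (x + y) - (x + z)       ≈⟨ +-congˡ (⁻¹-∙-comm x z) ⟨
      (x + y) + (- x + - z)   ≈⟨ +-congʳ (+-comm x y) ⟩
      (y + x) + (- x + - z)   ≈⟨ +-assoc y x _ ⟩
      y + (x + (- x + - z))   ≈⟨ +-congˡ (+-assoc x (- x) (- z)) ⟨
      y + ((x - x) + - z)     ≈⟨ +-congˡ (+-congʳ (-‿inverseʳ x)) ⟩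
      y + (0# + - z)          ≈⟨ +-congˡ (+-identityˡ (- z)) ⟩
      y - z                   ∎

  ⊖-homo : ∀ m n → ⟦ m ℤ.⊖ n ⟧ ≈ m · 1# - n · 1#
  ⊖-homo zero    zero    = sym (-‿inverseʳ 0#)
  ⊖-homo zero    (suc n) = sym (+-identityˡ _)
  ⊖-homo (suc m) zero    = sym (trans (+-congˡ ε⁻¹≈ε) (+-identityʳ _))
  ⊖-homo (suc m) (suc n) = begin
    ⟦ suc m ℤ.⊖ suc n ⟧               ≡⟨ ≡.cong ⟦_⟧ (ℤ.[1+m]⊖[1+n]≡m⊖n m n) ⟩
    ⟦ m ℤ.⊖ n ⟧                       ≈⟨ ⊖-homo m n ⟩
    m · 1# - n · 1#                   ≈⟨ cancel 1# _ _ ⟨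
    (1# + m · 1#) - (1# + n · 1#)     ≈⟨ +-cong (1+× m 1#) (-‿cong (1+× n 1#)) ⟨
    suc m · 1# - suc n · 1#           ∎

  +-homo : ∀ i j → ⟦ i ℤ.+ j ⟧ ≈ ⟦ i ⟧ + ⟦ j ⟧
  +-homo (+ m)      (+ n)      = ×-homo-+ 1# m n
  +-homo (+ m)      (-[1+ n ]) = ⊖-homo m (suc n)
  +-homo (-[1+ m ]) (+ n)      = trans (⊖-homo n (suc m)) (+-comm _ _)
  +-homo (-[1+ m ]) (-[1+ n ]) = begin
    - (suc (suc (m ℕ.+ n)) · 1#)        ≡⟨ ≡.cong (λ k → - (suc k · 1#)) (ℕ.+-suc m n) ⟨
    - ((suc m ℕ.+ suc n) · 1#)          ≈⟨ -‿cong (×-homo-+ 1# (suc m) (suc n)) ⟩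
    - (suc m · 1# + suc n · 1#)         ≈⟨ ⁻¹-∙-comm _ _ ⟨
    - (suc m · 1#) + - (suc n · 1#)     ∎

  -‿homo : ∀ i → ⟦ ℤ.- i ⟧ ≈ - ⟦ i ⟧
  -‿homo (+ zero)   = sym ε⁻¹≈ε
  -‿homo (+ suc n)  = refl
  -‿homo (-[1+ n ]) = sym (⁻¹-involutive _)

  ◃-homo⁺ : ∀ n → ⟦ Sign.+ ℤ.◃ n ⟧ ≈ n · 1#
  ◃-homo⁺ zero    = refl
  ◃-homo⁺ (suc n) = refl

  ◃-homo⁻ : ∀ n → ⟦ Sign.- ℤ.◃ n ⟧ ≈ - (n · 1#)
  ◃-homo⁻ zero    = sym ε⁻¹≈ε
  ◃-homo⁻ (suc n) = refl

  *-homo : ∀ i j → ⟦ i ℤ.* j ⟧ ≈ ⟦ i ⟧ * ⟦ j ⟧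
  *-homo (+ m)      (+ n)      = trans (◃-homo⁺ (m ℕ.* n)) (×1-homo-* m n)
  *-homo (+ m)      (-[1+ n ]) = begin
    ⟦ Sign.- ℤ.◃ (m ℕ.* suc n) ⟧   ≈⟨ ◃-homo⁻ (m ℕ.* suc n) ⟩
    - ((m ℕ.* suc n) · 1#)         ≈⟨ -‿cong (×1-homo-* m (suc n)) ⟩
    - (m · 1# * suc n · 1#)        ≈⟨ -‿distribʳ-* _ _ ⟩
    m · 1# * - (suc n · 1#)        ∎
  *-homo (-[1+ m ]) (+ n)      = begin
    ⟦ Sign.- ℤ.◃ (suc m ℕ.* n) ⟧   ≈⟨ ◃-homo⁻ (suc m ℕ.* n) ⟩
    - ((suc m ℕ.* n) · 1#)         ≈⟨ -‿cong (×1-homo-* (suc m) n) ⟩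
    - (suc m · 1# * n · 1#)        ≈⟨ -‿distribˡ-* _ _ ⟩
    - (suc m · 1#) * n · 1#        ∎
  *-homo (-[1+ m ]) (-[1+ n ]) = begin
    (suc m ℕ.* suc n) · 1#                  ≈⟨ ×1-homo-* (suc m) (suc n) ⟩
    suc m · 1# * suc n · 1#                 ≈⟨ ⁻¹-involutive _ ⟨
    - (- (suc m · 1# * suc n · 1#))         ≈⟨ -‿cong (-‿distribˡ-* _ _) ⟩
    - (- (suc m · 1#) * suc n · 1#)         ≈⟨ -‿distribʳ-* _ _ ⟩
    - (suc m · 1#) * - (suc n · 1#)         ∎

  morphism : ℤ.+-*-rawRing -Raw-AlmostCommutative⟶ fromCommutativeRing A
  morphism = record
    { ⟦_⟧ = ⟦_⟧ ; +-homo = +-homo ; *-homo = *-homo ; -‿homo = -‿homo ; 0-homo = refl ; 1-homo = refl }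

  -- To cancel terms such as `a - a` the solver must recognise equal coefficients by computation.
  -- Equality of the abstract carrier does not compute, that of integers does.
  _≟_ : WeaklyDecidable (Induced-equivalence morphism)
  i ≟ j with i ℤ.≟ j
  ... | yes i≡j = just (reflexive (≡.cong ⟦_⟧ i≡j))
  ... | no  _   = nothing

-- Ordered-field arithmetic, finite sums and limits

module RealLine ⦃ R : CompleteOrderedField ⦄ where
  open Theory ⦃ R ⦄ hiding (zero)

  open IntegerCoefficients commutativeRing using (morphism; _≟_)
  open RingSolver ℤ.+-*-rawRing (fromCommutativeRing commutativeRing) morphism _≟_ public
    using (solve; _:=_; _:+_; _:*_; _:-_; :-_; con)

  strictTotalOrder : StrictTotalOrder 0ℓ 0ℓ 0ℓ
  strictTotalOrder = record { isStrictTotalOrder = isStrictTotalOrder }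

  open StrictTotalOrder strictTotalOrder public
    using (compare; <-respˡ-≈; <-respʳ-≈)
    renaming (irrefl to <-irrefl; trans to <-trans; asym to <-asym)

  module ≤-Reasoning = StrictReasoning (StrictTotalOrder.strictPartialOrder strictTotalOrder)
  module ≈-Reasoning = SetoidReasoning setoid

  ≤-refl : ∀ {x} → x ≤ x
  ≤-refl = inj₂ refl

  ≤-reflexive : ∀ {x y} → x ≈ y → x ≤ y
  ≤-reflexive = inj₂

  <⇒≤ : ∀ {x y} → x < y → x ≤ y
  <⇒≤ = inj₁

  <-≤-trans : ∀ {x y z} → x < y → y ≤ z → x < z
  <-≤-trans x<y (inj₁ y<z) = <-trans x<y y<z
  <-≤-trans x<y (inj₂ y≈z) = <-respʳ-≈ y≈z x<y

  ≤-<-trans : ∀ {x y z} → x ≤ y → y < z → x < z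
  ≤-<-trans (inj₁ x<y) y<z = <-trans x<y y<z
  ≤-<-trans (inj₂ x≈y) y<z = <-respˡ-≈ (sym x≈y) y<z

  ≤-trans : ∀ {x y z} → x ≤ y → y ≤ z → x ≤ z
  ≤-trans (inj₁ x<y) y≤z = inj₁ (<-≤-trans x<y y≤z)
  ≤-trans (inj₂ x≈y) (inj₁ y<z) = inj₁ (<-respˡ-≈ (sym x≈y) y<z)
  ≤-trans (inj₂ x≈y) (inj₂ y≈z) = inj₂ (trans x≈y y≈z)

  ≤-resp : ∀ {x x′ y y′} → x ≈ x′ → y ≈ y′ → x ≤ y → x′ ≤ y′
  ≤-resp x≈x′ y≈y′ x≤y = ≤-trans (inj₂ (sym x≈x′)) (≤-trans x≤y (inj₂ y≈y′))

  <-resp : ∀ {x x′ y y′} → x ≈ x′ → y ≈ y′ → x < y → x′ < y′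
  <-resp x≈x′ y≈y′ x<y = <-respʳ-≈ y≈y′ (<-respˡ-≈ x≈x′ x<y)

  ≤⇒≯ : ∀ {x y} → x ≤ y → ¬ (y < x)
  ≤⇒≯ x≤y y<x = <-irrefl refl (<-≤-trans y<x x≤y)

  ≮⇒≥ : ∀ {x y} → ¬ (x < y) → y ≤ x
  ≮⇒≥ {x} {y} x≮y with compare x y
  ... | tri< x<y _ _ = ⊥-elim (x≮y x<y)
  ... | tri≈ _ x≈y _ = inj₂ (sym x≈y)
  ... | tri> _ _ y<x = inj₁ y<x

  ≤-antisym : ∀ {x y} → x ≤ y → y ≤ x → x ≈ y
  ≤-antisym (inj₂ x≈y) _   = x≈y
  ≤-antisym (inj₁ x<y) y≤x = ⊥-elim (≤⇒≯ y≤x x<y)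

  0<-slack : ∀ {x y} → x < y → 0# < y - x
  0<-slack {x} x<y = <-respˡ-≈ (-‿inverseʳ x) (+-monoˡ-< (- x) x<y)

  0≤-slack : ∀ {x y} → x ≤ y → 0# ≤ y - x
  0≤-slack     (inj₁ x<y) = inj₁ (0<-slack x<y)
  0≤-slack {x} (inj₂ x≈y) = inj₂ (trans (sym (-‿inverseʳ x)) (+-congʳ x≈y))

  -- Reduces an inequality to the sign of its slack and a ring identity that the solver can check.
  <-by : ∀ {x y d} → 0# < d → y - x ≈ d → x < y
  <-by {x} {y} 0<d eq = <-resp (+-identityˡ x) (solve 2 (λ x y → y :- x :+ x := y) refl x y)
    (+-monoˡ-< x (<-respʳ-≈ (sym eq) 0<d))

  ≤-by : ∀ {x y d} → 0# ≤ d → y - x ≈ d → x ≤ y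
  ≤-by         (inj₁ 0<d) eq = inj₁ (<-by 0<d eq)
  ≤-by {x} {y} (inj₂ 0≈d) eq = inj₂ (begin
    x           ≈⟨ +-identityˡ x ⟨
    0# + x      ≈⟨ +-congʳ (trans 0≈d (sym eq)) ⟩
    y - x + x   ≈⟨ solve 2 (λ x y → y :- x :+ x := y) refl x y ⟩
    y           ∎)
    where open ≈-Reasoning

  +-monoˡ-≤ : ∀ z {x y} → x ≤ y → x + z ≤ y + z
  +-monoˡ-≤ z (inj₁ x<y) = inj₁ (+-monoˡ-< z x<y)
  +-monoˡ-≤ z (inj₂ x≈y) = inj₂ (+-congʳ x≈y)

  +-monoʳ-≤ : ∀ z {x y} → x ≤ y → z + x ≤ z + y
  +-monoʳ-≤ z {x} {y} x≤y = ≤-resp (+-comm x z) (+-comm y z) (+-monoˡ-≤ z x≤y)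

  +-mono-≤ : ∀ {x y u v} → x ≤ y → u ≤ v → x + u ≤ y + v
  +-mono-≤ {y = y} {u = u} x≤y u≤v = ≤-trans (+-monoˡ-≤ u x≤y) (+-monoʳ-≤ y u≤v)

  +-mono-< : ∀ {x y u v} → x < y → u < v → x + u < y + v
  +-mono-< {y = y} {u = u} x<y u<v =
    <-trans (+-monoˡ-< u x<y) (<-resp (+-comm _ _) (+-comm _ _) (+-monoˡ-< y u<v))

  +-nonneg : ∀ {x y} → 0# ≤ x → 0# ≤ y → 0# ≤ x + y
  +-nonneg 0≤x 0≤y = ≤-resp (+-identityˡ 0#) refl (+-mono-≤ 0≤x 0≤y)

  x≤x+y : ∀ {x y} → 0# ≤ y → x ≤ x + y
  x≤x+y {x} 0≤y = ≤-resp (+-identityʳ x) refl (+-monoʳ-≤ x 0≤y)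

  *-nonneg : ∀ {x y} → 0# ≤ x → 0# ≤ y → 0# ≤ x * y
  *-nonneg         (inj₁ 0<x) (inj₁ 0<y) = inj₁ (*-pos 0<x 0<y)
  *-nonneg {x} {y} (inj₁ _)   (inj₂ 0≈y) = inj₂ (sym (trans (*-congˡ (sym 0≈y)) (zeroʳ x)))
  *-nonneg {x} {y} (inj₂ 0≈x) _          = inj₂ (sym (trans (*-congʳ (sym 0≈x)) (zeroˡ y)))

  *-monoʳ-≤ : ∀ {z} → 0# ≤ z → ∀ {x y} → x ≤ y → z * x ≤ z * y
  *-monoʳ-≤ {z} 0≤z {x} {y} x≤y = ≤-by (*-nonneg 0≤z (0≤-slack x≤y))
    (solve 3 (λ x y z → z :* y :- z :* x := z :* (y :- x)) refl x y z)

  *-monoˡ-≤ : ∀ {z} → 0# ≤ z → ∀ {x y} → x ≤ y → x * z ≤ y * z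
  *-monoˡ-≤ {z} 0≤z {x} {y} x≤y = ≤-resp (*-comm z x) (*-comm z y) (*-monoʳ-≤ 0≤z x≤y)

  *-monoʳ-< : ∀ {z} → 0# < z → ∀ {x y} → x < y → z * x < z * y
  *-monoʳ-< {z} 0<z {x} {y} x<y = <-by (*-pos 0<z (0<-slack x<y))
    (solve 3 (λ x y z → z :* y :- z :* x := z :* (y :- x)) refl x y z)

  *≤1′ : ∀ {x y} → 0# ≤ y → x ≤ 1# → x * y ≤ y
  *≤1′ {x} {y} 0≤y x≤1 = ≤-resp refl (*-identityˡ y) (*-monoˡ-≤ 0≤y x≤1)

  *≤1 : ∀ {x y} → 0# ≤ x → y ≤ 1# → x * y ≤ x
  *≤1 {x} 0≤x y≤1 = ≤-resp refl (*-identityʳ x) (*-monoʳ-≤ 0≤x y≤1)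

  neg-mono-< : ∀ {x y} → x < y → - y < - x
  neg-mono-< {x} {y} x<y = <-by (0<-slack x<y)
    (solve 2 (λ x y → :- x :- :- y := y :- x) refl x y)

  0≉1 : ¬ (0# ≈ 1#)
  0≉1 0≈1 = <-irrefl 0≈1 0<1

  0≤1 : 0# ≤ 1#
  0≤1 = inj₁ 0<1

  pos⇒≉0 : ∀ {x} → 0# < x → ¬ (x ≈ 0#)
  pos⇒≉0 0<x x≈0 = <-irrefl (sym x≈0) 0<x

  ⁻¹-inverseˡ : ∀ x → ¬ (x ≈ 0#) → x ⁻¹ * x ≈ 1#
  ⁻¹-inverseˡ x x≉0 = trans (*-comm _ x) (⁻¹-inverseʳ x x≉0)

  ⁻¹-unique : ∀ {x y} → x * y ≈ 1# → x ⁻¹ ≈ y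
  ⁻¹-unique {x} {y} xy≈1 = begin
    x ⁻¹              ≈⟨ *-identityʳ _ ⟨
    x ⁻¹ * 1#         ≈⟨ *-congˡ xy≈1 ⟨
    x ⁻¹ * (x * y)    ≈⟨ *-assoc _ x y ⟨
    (x ⁻¹ * x) * y    ≈⟨ *-congʳ (⁻¹-inverseˡ x x≉0) ⟩
    1# * y            ≈⟨ *-identityˡ y ⟩
    y                 ∎
    where
    open ≈-Reasoning
    x≉0 : ¬ (x ≈ 0#)
    x≉0 x≈0 = 0≉1 (trans (sym (zeroˡ y)) (trans (*-congʳ (sym x≈0)) xy≈1))

  ⁻¹-pos : ∀ {x} → 0# < x → 0# < x ⁻¹
  ⁻¹-pos {x} 0<x with compare 0# (x ⁻¹)
  ... | tri< 0<x⁻¹ _ _ = 0<x⁻¹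
  ... | tri≈ _ 0≈x⁻¹ _ = ⊥-elim (0≉1 (trans (sym (zeroʳ x))
    (trans (*-congˡ 0≈x⁻¹) (⁻¹-inverseʳ x (pos⇒≉0 0<x)))))
  ... | tri> _ _ x⁻¹<0 = ⊥-elim (<-asym 0<1
    (<-resp (⁻¹-inverseʳ x (pos⇒≉0 0<x)) (zeroʳ x) (*-monoʳ-< 0<x x⁻¹<0)))

  ⁻¹-nonneg : ∀ {x} → 0# ≤ x → 0# ≤ x ⁻¹
  ⁻¹-nonneg     (inj₁ 0<x) = inj₁ (⁻¹-pos 0<x)
  ⁻¹-nonneg {x} (inj₂ 0≈x) = inj₂ (sym (⁻¹-zero x (sym 0≈x)))

  half : ∀ {x} → 0# < x → ∃[ y ] 0# < y × y + y ≈ x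
  half {x} 0<x = x * ½ , *-pos 0<x (⁻¹-pos 0<2) , (begin
    x * ½ + x * ½    ≈⟨ solve 2 (λ x h → x :* h :+ x :* h := x :* ((con ℤ.1ℤ :+ con ℤ.1ℤ) :* h)) refl x ½ ⟩
    x * ((1# + 1#) * ½) ≈⟨ *-congˡ (⁻¹-inverseʳ _ (pos⇒≉0 0<2)) ⟩
    x * 1#           ≈⟨ *-identityʳ x ⟩
    x                ∎)
    where
    open ≈-Reasoning
    ½ = (1# + 1#) ⁻¹
    0<2 : 0# < 1# + 1#
    0<2 = <-respˡ-≈ (+-identityˡ 0#) (+-mono-< 0<1 0<1)

  between : ∀ {x y} → x < y → ∃[ z ] x < z × z < y
  between {x} {y} x<y with half (0<-slack x<y)
  ... | d , 0<d , 2d≈ = x + d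
      , <-by 0<d (solve 2 (λ x d → x :+ d :- x := d) refl x d)
      , <-by 0<d (begin
          y - (x + d)       ≈⟨ solve 3 (λ x y d → y :- (x :+ d) := (y :- x) :- d) refl x y d ⟩
          (y - x) - d       ≈⟨ +-congʳ 2d≈ ⟨
          (d + d) - d       ≈⟨ solve 1 (λ d → d :+ d :- d := d) refl d ⟩
          d                 ∎)
    where open ≈-Reasoning

  -- The deficit is shared equally between the two summands. This is the continuity of addition in
  -- the one-sided form used for limits and suprema.
  <-+-split : ∀ {y s t} → y < s + t → ∃[ u ] ∃[ v ] u < s × v < t × y ≈ u + v
  <-+-split {y} {s} {t} y<s+t with half (0<-slack y<s+t)
  ... | d , 0<d , 2d≈ = s - d , t - d , lt s , lt t , (begin
        y                       ≈⟨ solve 3 (λ y s t → y := s :+ t :- (s :+ t :- y)) refl y s t ⟩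
        s + t - (s + t - y)     ≈⟨ +-congˡ (-‿cong 2d≈) ⟨
        s + t - (d + d)         ≈⟨ solve 3 (λ s t d → s :+ t :- (d :+ d) := (s :- d) :+ (t :- d)) refl s t d ⟩
        (s - d) + (t - d)       ∎)
    where
    open ≈-Reasoning
    lt : ∀ s → s - d < s
    lt s = <-by 0<d (solve 2 (λ s d → s :- (s :- d) := d) refl s d)

  *-cancel-⁻¹ : ∀ {c} x → 0# < c → c ⁻¹ * (c * x) ≈ x
  *-cancel-⁻¹ {c} x 0<c = trans (sym (*-assoc _ c x)) (trans (*-congʳ (⁻¹-inverseˡ c (pos⇒≉0 0<c))) (*-identityˡ x))

  *-cancel-⁻¹′ : ∀ {c} x → 0# < c → c * (c ⁻¹ * x) ≈ x
  *-cancel-⁻¹′ {c} x 0<c = trans (sym (*-assoc c _ x)) (trans (*-congʳ (⁻¹-inverseʳ c (pos⇒≉0 0<c))) (*-identityˡ x))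

  fromℕ-nonneg : ∀ n → 0# ≤ fromℕ n
  fromℕ-nonneg zero    = ≤-refl
  fromℕ-nonneg (suc n) = +-nonneg 0≤1 (fromℕ-nonneg n)

  fromℕ-homo : ∀ m n → fromℕ (m ℕ.+ n) ≈ fromℕ m + fromℕ n
  fromℕ-homo zero    n = sym (+-identityˡ _)
  fromℕ-homo (suc m) n = trans (+-congˡ (fromℕ-homo m n)) (sym (+-assoc 1# _ _))

  fromℕ-mono : ∀ {m n} → m ℕ.≤ n → fromℕ m ≤ fromℕ n
  fromℕ-mono {n = n} ℕ.z≤n = fromℕ-nonneg n
  fromℕ-mono (ℕ.s≤s m≤n) = +-monoʳ-≤ 1# (fromℕ-mono m≤n)

  -- Sums over an initial segment of ℕ

  σ : ℕ → (ℕ → ℝ) → ℝ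
  σ zero    f = 0#
  σ (suc n) f = f 0 + σ n (f ∘ suc)

  finiteSum-upTo : ∀ f n → finiteSum f (upTo n) ≡ σ n f
  finiteSum-upTo f n = go id n
    where
    go : ∀ g n → finiteSum f (applyUpTo g n) ≡ σ n (f ∘ g)
    go g zero    = ≡.refl
    go g (suc n) = ≡.cong (f (g 0) +_) (go (g ∘ suc) n)

  σ-cong : ∀ n {f g} → (∀ k → k ℕ.< n → f k ≈ g k) → σ n f ≈ σ n g
  σ-cong zero    f≈g = refl
  σ-cong (suc n) f≈g = +-cong (f≈g 0 ℕ.z<s) (σ-cong n λ k k<n → f≈g (suc k) (ℕ.s<s k<n))

  σ-mono : ∀ n {f g} → (∀ k → k ℕ.< n → f k ≤ g k) → σ n f ≤ σ n g
  σ-mono zero    f≤g = ≤-refl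
  σ-mono (suc n) f≤g = +-mono-≤ (f≤g 0 ℕ.z<s) (σ-mono n λ k k<n → f≤g (suc k) (ℕ.s<s k<n))

  σ-nonneg : ∀ n {f} → (∀ k → 0# ≤ f k) → 0# ≤ σ n f
  σ-nonneg zero    0≤f = ≤-refl
  σ-nonneg (suc n) 0≤f = +-nonneg (0≤f 0) (σ-nonneg n (0≤f ∘ suc))

  σ-* : ∀ n c f → σ n (λ k → c * f k) ≈ c * σ n f
  σ-* zero    c f = sym (zeroʳ c)
  σ-* (suc n) c f = trans (+-congˡ (σ-* n c (f ∘ suc))) (sym (distribˡ c _ _))

  σ-split : ∀ m n f → σ (m ℕ.+ n) f ≈ σ m f + σ n (f ∘ (m ℕ.+_))
  σ-split zero    n f = sym (+-identityˡ _)
  σ-split (suc m) n f = trans (+-congˡ (σ-split m n (f ∘ suc))) (sym (+-assoc _ _ _))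

  σ-last : ∀ n f → σ (suc n) f ≈ σ n f + f n
  σ-last zero    f = +-comm _ _
  σ-last (suc n) f = trans (+-congˡ (σ-last n (f ∘ suc))) (sym (+-assoc _ _ _))

  σ-monoˡ : ∀ {m n f} → (∀ k → 0# ≤ f k) → m ℕ.≤ n → σ m f ≤ σ n f
  σ-monoˡ {m} {n} {f} 0≤f m≤n = ≤-resp refl
    (trans (sym (σ-split m (n ℕ.∸ m) f)) (reflexive (≡.cong (λ k → σ k f) (ℕ.m+[n∸m]≡n m≤n))))
    (x≤x+y (σ-nonneg (n ℕ.∸ m) λ k → 0≤f (m ℕ.+ k)))

  -- Limits of sequences, through the order topology

  Eventually : (ℕ → Set) → Set
  Eventually Q = ∃[ N ] ∀ n → N ℕ.≤ n → Q n

  eventually-map : ∀ {Q Q′ : ℕ → Set} → (∀ n → Q n → Q′ n) → Eventually Q → Eventually Q′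
  eventually-map f (N , h) = N , λ n N≤n → f n (h n N≤n)

  eventually-zip : ∀ {Q Q′ Q″ : ℕ → Set} → (∀ n → Q n → Q′ n → Q″ n) →
                   Eventually Q → Eventually Q′ → Eventually Q″
  eventually-zip f (M , h) (N , k) = M ℕ.⊔ N , λ n le →
    f n (h n (ℕ.m⊔n≤o⇒m≤o M N le)) (k n (ℕ.m⊔n≤o⇒n≤o M N le))

  -- Two one-sided conditions replace the absolute value: each half can be proved from order alone,
  -- and negation exchanges them.
  record Tends (a : ℕ → ℝ) (s : ℝ) : Set where
    constructor mkTends
    field
      above : ∀ {y} → y < s → Eventually λ n → y < a n
      below : ∀ {y} → s < y → Eventually λ n → a n < y
  open Tends public

  tends-unique : ∀ {a s t} → Tends a s → Tends a t → s ≈ t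
  tends-unique a→s a→t = ≤-antisym (le a→s a→t) (le a→t a→s)
    where
    le : ∀ {a s t} → Tends a s → Tends a t → s ≤ t
    le a→s a→t = ≮⇒≥ λ t<s →
      let z , t<z , z<s = between t<s
          N , h = eventually-zip (λ _ → <-trans) (above a→s z<s) (below a→t t<z)
      in <-irrefl refl (h N ℕ.≤-refl)

  tends-cong : ∀ {a b s t} → Eventually (λ n → a n ≈ b n) → s ≈ t → Tends a s → Tends b t
  tends-cong a≈b s≈t a→s = mkTends
    (λ y<t → eventually-zip (λ _ → <-respʳ-≈) a≈b (above a→s (<-respʳ-≈ (sym s≈t) y<t)))
    (λ t<y → eventually-zip (λ _ → <-respˡ-≈) a≈b (below a→s (<-respˡ-≈ (sym s≈t) t<y)))

  always : ∀ {Q : ℕ → Set} → (∀ n → Q n) → Eventually Q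
  always q = 0 , λ n _ → q n

  tends-const : ∀ c → Tends (λ _ → c) c
  tends-const c = mkTends (λ y<c → always λ _ → y<c) (λ c<y → always λ _ → c<y)

  tends-≥ : ∀ {a s c} → Tends a s → (∀ n → c ≤ a n) → c ≤ s
  tends-≥ a→s c≤a = ≮⇒≥ λ s<c → let N , h = below a→s s<c in ≤⇒≯ (c≤a N) (h N ℕ.≤-refl)

  tends-neg : ∀ {a s} → Tends a s → Tends (λ n → - a n) (- s)
  tends-neg {a} {s} a→s = mkTends
    (λ {y} y<-s → eventually-map (λ n → <-respˡ-≈ (neg² y) ∘ neg-mono-<)
      (below a→s (<-respˡ-≈ (neg² s) (neg-mono-< y<-s))))
    (λ {y} -s<y → eventually-map (λ n → <-respʳ-≈ (neg² y) ∘ neg-mono-<)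
      (above a→s (<-respʳ-≈ (neg² s) (neg-mono-< -s<y))))
    where
    neg² : ∀ x → - (- x) ≈ x
    neg² = solve 1 (λ x → :- (:- x) := x) refl

  tends-+ : ∀ {a b s t} → Tends a s → Tends b t → Tends (λ n → a n + b n) (s + t)
  tends-+ {a} {b} {s} {t} a→s b→t = mkTends (lower a→s b→t) upper
    where
    lower : ∀ {a b s t} → Tends a s → Tends b t → ∀ {y} → y < s + t → Eventually λ n → y < a n + b n
    lower a→s b→t y< with <-+-split y<
    ... | u , v , u<s , v<t , y≈ = eventually-zip
      (λ n u<a v<b → <-respˡ-≈ (sym y≈) (+-mono-< u<a v<b)) (above a→s u<s) (above b→t v<t)

    neg-+ : ∀ x y → - (x + y) ≈ - x + - y
    neg-+ = solve 2 (λ x y → :- (x :+ y) := :- x :+ :- y) refl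

    -- The upper half is the lower half for the negated sequences.
    upper : ∀ {y} → s + t < y → Eventually λ n → a n + b n < y
    upper {y} <y = eventually-map
      (λ n lt → <-by (0<-slack lt)
        (solve 3 (λ y a b → y :- (a :+ b) := :- a :+ :- b :- :- y) refl y (a n) (b n)))
      (lower (tends-neg a→s) (tends-neg b→t) (<-respʳ-≈ (neg-+ s t) (neg-mono-< <y)))

  -- The main case divides the bound by `c`, so `c ≈ 0#` is split off.
  tends-*ˡ : ∀ {a s c} → 0# ≤ c → Tends a s → Tends (λ n → c * a n) (c * s)
  tends-*ˡ {a} {s} {c} (inj₂ 0≈c) a→s =
    tends-cong (always λ n → sym (z (a n))) (sym (z s)) (tends-const 0#)
    where
    z : ∀ x → c * x ≈ 0#
    z x = trans (*-congʳ (sym 0≈c)) (zeroˡ x)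
  tends-*ˡ {a} {s} {c} (inj₁ 0<c) a→s = mkTends
    (λ {y} y<cs → eventually-map (λ n lt → <-respˡ-≈ (*-cancel-⁻¹′ y 0<c) (*-monoʳ-< 0<c lt))
      (above a→s (<-respʳ-≈ (*-cancel-⁻¹ s 0<c) (*-monoʳ-< (⁻¹-pos 0<c) y<cs))))
    (λ {y} cs<y → eventually-map (λ n lt → <-respʳ-≈ (*-cancel-⁻¹′ y 0<c) (*-monoʳ-< 0<c lt))
      (below a→s (<-respˡ-≈ (*-cancel-⁻¹ s 0<c) (*-monoʳ-< (⁻¹-pos 0<c) cs<y))))

  tends-*ʳ : ∀ {a s c} → 0# ≤ c → Tends a s → Tends (λ n → a n * c) (s * c)
  tends-*ʳ {c = c} 0≤c a→s = tends-cong (always λ n → *-comm c _) (*-comm c _) (tends-*ˡ 0≤c a→s)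

  tends-suc : ∀ {a s} → Tends a s → Tends (a ∘ suc) s
  tends-suc a→s = mkTends (shift ∘ above a→s) (shift ∘ below a→s)
    where
    shift : ∀ {Q : ℕ → Set} → Eventually Q → Eventually (Q ∘ suc)
    shift (N , h) = N , λ n N≤n → h (suc n) (ℕ.m≤n⇒m≤1+n N≤n)

  tends-shift : ∀ {a s} k → Tends a s → Tends (λ n → a (k ℕ.+ n)) s
  tends-shift k a→s = mkTends (shift ∘ above a→s) (shift ∘ below a→s)
    where
    shift : ∀ {Q : ℕ → Set} → Eventually Q → Eventually (λ n → Q (k ℕ.+ n))
    shift (N , h) = N , λ n N≤n → h (k ℕ.+ n) (ℕ.≤-trans N≤n (ℕ.m≤n+m n k))

  tends-∸ : ∀ {a s} k → Tends a s → Tends (λ n → a (n ℕ.∸ k)) s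
  tends-∸ k a→s = mkTends (shift ∘ above a→s) (shift ∘ below a→s)
    where
    shift : ∀ {Q : ℕ → Set} → Eventually Q → Eventually (λ n → Q (n ℕ.∸ k))
    shift (N , h) = k ℕ.+ N , λ n k+N≤n → h (n ℕ.∸ k) (ℕ.m+n≤o⇒m≤o∸n N (≡.subst (ℕ._≤ n) (ℕ.+-comm k N) k+N≤n))

  tends-σ : ∀ k {f : ℕ → ℕ → ℝ} {s : ℕ → ℝ} → (∀ j → Tends (λ n → f n j) (s j)) →
            Tends (λ n → σ k (f n)) (σ k s)
  tends-σ zero    f→s = tends-const 0#
  tends-σ (suc k) f→s = tends-+ (f→s 0) (tends-σ k (f→s ∘ suc))

  Close⇒ : ∀ {ε x s} → Close ε x s → s - ε < x × x < s + ε
  Close⇒ {ε} {x} {s} (x-s<ε , s-x<ε) =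
      <-by (0<-slack s-x<ε) (solve 3 (λ x s ε → x :- (s :- ε) := ε :- (s :- x)) refl x s ε)
    , <-by (0<-slack x-s<ε) (solve 3 (λ x s ε → s :+ ε :- x := ε :- (x :- s)) refl x s ε)

  ⇒Close : ∀ {ε x s} → s - ε < x → x < s + ε → Close ε x s
  ⇒Close {ε} {x} {s} lo hi =
      <-by (0<-slack hi) (solve 3 (λ x s ε → ε :- (x :- s) := s :+ ε :- x) refl x s ε)
    , <-by (0<-slack lo) (solve 3 (λ x s ε → ε :- (s :- x) := x :- (s :- ε)) refl x s ε)

  sub-lt : ∀ {ε} s → 0# < ε → s - ε < s
  sub-lt {ε} s 0<ε = <-by 0<ε (solve 2 (λ s ε → s :- (s :- ε) := ε) refl s ε)

  add-gt : ∀ {ε} s → 0# < ε → s < s + ε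
  add-gt {ε} s 0<ε = <-by 0<ε (solve 2 (λ s ε → s :+ ε :- s := ε) refl s ε)

  sub-sub : ∀ s y → s - (s - y) ≈ y
  sub-sub = solve 2 (λ s y → s :- (s :- y) := y) refl

  add-sub : ∀ s y → s + (y - s) ≈ y
  add-sub = solve 2 (λ s y → s :+ (y :- s) := y) refl

  HasSeriesSum⇒Tends : ∀ {a s} → HasSeriesSum a s → Tends (λ n → σ n a) s
  HasSeriesSum⇒Tends {a} {s} h = mkTends
    (λ {y} y<s → eventually-map
      (λ n c → <-resp (sub-sub s y) (reflexive (finiteSum-upTo a n)) (proj₁ (Close⇒ c))) (h (s - y) (0<-slack y<s)))
    (λ {y} s<y → eventually-map
      (λ n c → <-resp (reflexive (finiteSum-upTo a n)) (add-sub s y) (proj₂ (Close⇒ c))) (h (y - s) (0<-slack s<y)))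

-- Unordered sums of nonnegative families

module Summation ⦃ R : CompleteOrderedField ⦄ where
  open Theory ⦃ R ⦄ hiding (zero)
  open RealLine ⦃ R ⦄

  finiteSum-cong : {I : Set} {f g : I → ℝ} → (∀ i → f i ≈ g i) → ∀ is → finiteSum f is ≈ finiteSum g is
  finiteSum-cong f≈g []       = refl
  finiteSum-cong f≈g (i ∷ is) = +-cong (f≈g i) (finiteSum-cong f≈g is)

  finiteSum-mono : {I : Set} {f g : I → ℝ} → (∀ i → f i ≤ g i) → ∀ is → finiteSum f is ≤ finiteSum g is
  finiteSum-mono f≤g []       = ≤-refl
  finiteSum-mono f≤g (i ∷ is) = +-mono-≤ (f≤g i) (finiteSum-mono f≤g is)

  finiteSum-nonneg : {I : Set} {f : I → ℝ} → (∀ i → 0# ≤ f i) → ∀ is → 0# ≤ finiteSum f is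
  finiteSum-nonneg 0≤f []       = ≤-refl
  finiteSum-nonneg 0≤f (i ∷ is) = +-nonneg (0≤f i) (finiteSum-nonneg 0≤f is)

  finiteSum-+ : {I : Set} (f g : I → ℝ) → ∀ is → finiteSum (λ i → f i + g i) is ≈ finiteSum f is + finiteSum g is
  finiteSum-+ f g []       = sym (+-identityˡ 0#)
  finiteSum-+ f g (i ∷ is) = trans (+-congˡ (finiteSum-+ f g is))
    (solve 4 (λ a b c d → a :+ b :+ (c :+ d) := a :+ c :+ (b :+ d)) refl _ _ _ _)

  finiteSum-* : {I : Set} (c : ℝ) (f : I → ℝ) → ∀ is → finiteSum (λ i → c * f i) is ≈ c * finiteSum f is
  finiteSum-* c f []       = sym (zeroʳ c)
  finiteSum-* c f (i ∷ is) = trans (+-congˡ (finiteSum-* c f is)) (sym (distribˡ c _ _))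

  finiteSum-insert : {I : Set} (f : I → ℝ) (x : I) → ∀ is {js} →
                     finiteSum f (is ++ x ∷ js) ≈ f x + finiteSum f (is ++ js)
  finiteSum-insert f x []       = refl
  finiteSum-insert f x (i ∷ is) = trans (+-congˡ (finiteSum-insert f x is))
    (solve 3 (λ a b c → a :+ (b :+ c) := b :+ (a :+ c)) refl _ _ _)

  -- Each element of `js` with a possibly nonzero term is located in `is` and removed there. As `js`
  -- has no duplicates, the removed occurrence is not asked for again.
  finiteSum-≤-support : {I : Set} {f : I → ℝ} → (∀ i → 0# ≤ f i) → ∀ {js is} → Unique js →
                        (∀ {x} → x ∈ js → x ∈ is ⊎ f x ≈ 0#) → finiteSum f js ≤ finiteSum f is
  finiteSum-≤-support         0≤f {[]}     {is} _          _    = finiteSum-nonneg 0≤f is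
  finiteSum-≤-support {f = f} 0≤f {x ∷ js} {is} (x∉js ∷ !) supp with supp (here ≡.refl)
  ... | inj₂ fx≈0 = ≤-trans (≤-reflexive (trans (+-congʳ fx≈0) (+-identityˡ _)))
                            (finiteSum-≤-support 0≤f ! (supp ∘ there))
  ... | inj₁ x∈is with ∈-∃++ x∈is
  ...   | ys , zs , ≡.refl = ≤-resp refl (sym (finiteSum-insert f x ys))
            (+-monoʳ-≤ (f x) (finiteSum-≤-support 0≤f ! supp′))
    where
    remove : ∀ {y} → y ∈ js → y ∈ ys ++ x ∷ zs → y ∈ ys ++ zs
    remove y∈js y∈ with ∈-++⁻ ys y∈
    ... | inj₁ y∈ys           = ∈-++⁺ˡ y∈ys
    ... | inj₂ (here ≡.refl)  = ⊥-elim (All¬⇒¬Any x∉js y∈js)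
    ... | inj₂ (there y∈zs)   = ∈-++⁺ʳ ys y∈zs

    supp′ : ∀ {y} → y ∈ js → y ∈ ys ++ zs ⊎ f y ≈ 0#
    supp′ y∈js with supp (there y∈js)
    ... | inj₁ y∈   = inj₁ (remove y∈js y∈)
    ... | inj₂ fy≈0 = inj₂ fy≈0

  finiteSum-⊆ : {I : Set} {f : I → ℝ} → (∀ i → 0# ≤ f i) → ∀ {js is} → Unique js → js ⊆ is →
                finiteSum f js ≤ finiteSum f is
  finiteSum-⊆ 0≤f ! js⊆is = finiteSum-≤-support 0≤f ! (inj₁ ∘ js⊆is)

  -- Forms unions of finite index sets. The index types carry no decidable equality, so `lem`
  -- supplies it.
  nub : {I : Set} → List I → List I
  nub = deduplicate (λ x y → lem (x ≡ y))

  nub-! : {I : Set} (is : List I) → Unique (nub is)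
  nub-! = deduplicate-! (λ x y → lem (x ≡ y))

  ∈-nub : {I : Set} {is : List I} → is ⊆ nub is
  ∈-nub = ∈-deduplicate⁺ (λ x y → lem (x ≡ y))

  -- For nonnegative terms the unordered sum is the supremum of the finite sums.
  record SumsTo {I : Set} (f : I → ℝ) (s : ℝ) : Set where
    field
      nonneg   : ∀ i → 0# ≤ f i
      bound    : ∀ {is} → Unique is → finiteSum f is ≤ s
      approach : ∀ {y} → y < s → ∃[ is ] Unique is × y < finiteSum f is
  open SumsTo public

  sumsTo-mono : {I : Set} {f g : I → ℝ} {s t : ℝ} → (∀ i → f i ≤ g i) → SumsTo f s → SumsTo g t → s ≤ t
  sumsTo-mono f≤g Σf Σg = ≮⇒≥ λ t<s →
    let is , ! , t<f = approach Σf t<s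
    in ≤⇒≯ (≤-trans (finiteSum-mono f≤g is) (bound Σg !)) t<f

  sumsTo-unique : {I : Set} {f : I → ℝ} {s t : ℝ} → SumsTo f s → SumsTo f t → s ≈ t
  sumsTo-unique Σf Σf′ = ≤-antisym (sumsTo-mono (λ _ → ≤-refl) Σf Σf′) (sumsTo-mono (λ _ → ≤-refl) Σf′ Σf)

  sumsTo-cong : {I : Set} {f g : I → ℝ} {s t : ℝ} → (∀ i → f i ≈ g i) → s ≈ t → SumsTo f s → SumsTo g t
  sumsTo-cong f≈g s≈t Σf = record
    { nonneg   = λ i → ≤-resp refl (f≈g i) (nonneg Σf i)
    ; bound    = λ {is} ! → ≤-resp (finiteSum-cong f≈g is) s≈t (bound Σf !)
    ; approach = λ y<t → let is , ! , lt = approach Σf (<-respʳ-≈ (sym s≈t) y<t)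
                         in is , ! , <-respʳ-≈ (finiteSum-cong f≈g is) lt
    }

  sumsTo-support : {I : Set} {f : I → ℝ} → (∀ i → 0# ≤ f i) → ∀ {is} → Unique is →
                   (∀ x → x ∈ is ⊎ f x ≈ 0#) → SumsTo f (finiteSum f is)
  sumsTo-support 0≤f {is} ! supp = record
    { nonneg   = 0≤f
    ; bound    = λ !js → finiteSum-≤-support 0≤f !js (λ {x} _ → supp x)
    ; approach = λ y<s → is , ! , y<s
    }

  sumsTo-0 : {I : Set} → SumsTo {I} (λ _ → 0#) 0#
  sumsTo-0 = sumsTo-support (λ _ → ≤-refl) {[]} [] (λ _ → inj₂ refl)

  sumsTo-+ : {I : Set} {f g : I → ℝ} {s t : ℝ} → SumsTo f s → SumsTo g t → SumsTo (λ i → f i + g i) (s + t)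
  sumsTo-+ {f = f} {g} {s} {t} Σf Σg = record
    { nonneg   = λ i → +-nonneg (nonneg Σf i) (nonneg Σg i)
    ; bound    = λ {is} ! → ≤-resp (sym (finiteSum-+ f g is)) refl (+-mono-≤ (bound Σf !) (bound Σg !))
    ; approach = λ y<s+t →
        let u , v , u<s , v<t , y≈u+v = <-+-split y<s+t
            is , !is , u<f = approach Σf u<s
            js , !js , v<g = approach Σg v<t
            -- A common list for both approximations: enlarging a list can only increase a sum of
            -- nonnegative terms.
            ks = nub (is ++ js)
        in ks , nub-! (is ++ js) , <-resp (sym y≈u+v) (sym (finiteSum-+ f g ks))
             (+-mono-< (<-≤-trans u<f (finiteSum-⊆ (nonneg Σf) !is (∈-nub ∘ ∈-++⁺ˡ)))
                       (<-≤-trans v<g (finiteSum-⊆ (nonneg Σg) !js (∈-nub ∘ ∈-++⁺ʳ is))))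
    }

  sumsTo-* : {I : Set} {f : I → ℝ} {c s : ℝ} → 0# ≤ c → SumsTo f s → SumsTo (λ i → c * f i) (c * s)
  sumsTo-* {f = f} {c} {s} (inj₂ 0≈c) Σf = sumsTo-cong (λ i → 0≈c* (f i)) (0≈c* s) sumsTo-0
    where
    0≈c* : ∀ x → 0# ≈ c * x
    0≈c* x = sym (trans (*-congʳ (sym 0≈c)) (zeroˡ x))
  sumsTo-* {f = f} {c} {s} (inj₁ 0<c) Σf = record
    { nonneg   = λ i → *-nonneg (<⇒≤ 0<c) (nonneg Σf i)
    ; bound    = λ {is} ! → ≤-resp (sym (finiteSum-* c f is)) refl (*-monoʳ-≤ (<⇒≤ 0<c) (bound Σf !))
    ; approach = λ {y} y<cs →
        let is , ! , lt = approach Σf (<-respʳ-≈ (*-cancel-⁻¹ s 0<c) (*-monoʳ-< (⁻¹-pos 0<c) y<cs))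
        in is , ! , <-resp (*-cancel-⁻¹′ y 0<c) (sym (finiteSum-* c f is)) (*-monoʳ-< 0<c lt)
    }

  sumsTo-finiteSum : {I J : Set} {f : J → I → ℝ} {F : J → ℝ} → (∀ j → SumsTo (f j) (F j)) →
                     ∀ js → SumsTo (λ i → finiteSum (λ j → f j i) js) (finiteSum F js)
  sumsTo-finiteSum Σf []       = sumsTo-0
  sumsTo-finiteSum Σf (j ∷ js) = sumsTo-+ (Σf j) (sumsTo-finiteSum Σf js)

  sumsTo-σ : {I : Set} {f : ℕ → I → ℝ} {F : ℕ → ℝ} → ∀ n → (∀ k → SumsTo (f k) (F k)) →
             SumsTo (λ i → σ n (λ k → f k i)) (σ n F)
  sumsTo-σ zero    Σf = sumsTo-0
  sumsTo-σ (suc n) Σf = sumsTo-+ (Σf 0) (sumsTo-σ n (Σf ∘ suc))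

  sumsTo-term-≤ : {I : Set} {f : I → ℝ} {s : ℝ} → SumsTo f s → ∀ i → f i ≤ s
  sumsTo-term-≤ Σf i = ≤-resp (+-identityʳ _) refl (bound Σf {i ∷ []} (All.[] ∷ []))

  -- A finite block of columns is dominated row by row by `F`, which gives the bound. Conversely,
  -- finitely many rows nearly exhaust `s`, and finitely many columns nearly exhaust those rows.
  -- Summability of the column totals is part of the conclusion.
  tonelli : {I J : Set} {f : I → J → ℝ} {F : I → ℝ} {G : J → ℝ} {s : ℝ} →
            (∀ i → SumsTo (f i) (F i)) → (∀ j → SumsTo (λ i → f i j) (G j)) → SumsTo F s → SumsTo G s
  tonelli {f = f} rows cols ΣF = record
    { nonneg   = λ j → bound (cols j) {[]} []
    ; bound    = λ {js} ! → sumsTo-mono (λ i → bound (rows i) !) (sumsTo-finiteSum cols js) ΣF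
    ; approach = λ y<s →
        let is , !is , y<F  = approach ΣF y<s
            js , !js , y<f  = approach (sumsTo-finiteSum rows is) y<F
        in js , !js , <-≤-trans y<f (finiteSum-mono (λ j → bound (cols j) !is) js)
    }

  -- The supremum exists by completeness, whose approximation clause is exactly `approach`.
  sumsTo-bounded : {I : Set} {f : I → ℝ} {b : ℝ} → (∀ i → 0# ≤ f i) →
                   (∀ {is} → Unique is → finiteSum f is ≤ b) → ∃ (SumsTo f)
  sumsTo-bounded {f = f} {b} 0≤f f≤b = proj₁ sup , record
    { nonneg   = 0≤f
    ; bound    = λ ! → proj₁ (proj₂ sup) _ (_ , ! , ≡.refl)
    ; approach = λ y<s → case proj₂ (proj₂ sup) _ y<s of λ { (_ , (is , ! , ≡.refl) , y<f) → is , ! , y<f }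
    }
    where
    sup = complete (λ x → ∃[ is ] Unique is × finiteSum f is ≡ x) (_ , [] , [] , ≡.refl)
            (b , λ { _ (_ , ! , ≡.refl) → f≤b ! })

  sumsTo-dominated : {I : Set} {f g : I → ℝ} {s : ℝ} → (∀ i → 0# ≤ f i) → (∀ i → f i ≤ g i) →
                     SumsTo g s → ∃ (SumsTo f)
  sumsTo-dominated 0≤f f≤g Σg = sumsTo-bounded 0≤f (λ {is} ! → ≤-trans (finiteSum-mono f≤g is) (bound Σg !))

  -- Serves to transport countable additivity along a coding into ℕ, and to drop the state `i` from
  -- a sum over all states.
  sumsTo-restrict : {I J : Set} {f : I → ℝ} {s : ℝ} (ι : J → I) → (∀ {j k} → ι j ≡ ι k → j ≡ k) →
                    (∀ x → ¬ (∃[ j ] ι j ≡ x) → f x ≈ 0#) → SumsTo f s → SumsTo (f ∘ ι) s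
  sumsTo-restrict {J = J} {f = f} ι ι-injective f≈0 Σf = record
    { nonneg   = nonneg Σf ∘ ι
    ; bound    = λ {js} ! → ≤-resp (finiteSum-map js) refl (bound Σf (map⁺ ι-injective !))
    ; approach = λ y<s →
        let is , ! , y<f = approach Σf y<s
            js , cover = preimage is
        in nub js , nub-! js , <-≤-trans y<f (≤-resp refl (finiteSum-map (nub js))
             (finiteSum-≤-support (nonneg Σf) ! (mapNub js ∘ cover)))
    }
    where
    finiteSum-map : ∀ js → finiteSum f (map ι js) ≈ finiteSum (f ∘ ι) js
    finiteSum-map []       = refl
    finiteSum-map (j ∷ js) = +-congˡ (finiteSum-map js)

    mapNub : ∀ js {x} → x ∈ map ι js ⊎ f x ≈ 0# → x ∈ map ι (nub js) ⊎ f x ≈ 0#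
    mapNub js (inj₂ fx≈0) = inj₂ fx≈0
    mapNub js (inj₁ x∈) with ∈-map⁻ ι x∈
    ... | j , j∈js , ≡.refl = inj₁ (∈-map⁺ ι (∈-nub j∈js))

    preimage : ∀ is → ∃[ js ] (∀ {x} → x ∈ is → x ∈ map ι js ⊎ f x ≈ 0#)
    preimage []       = [] , λ ()
    preimage (i ∷ is) with preimage is | lem (∃[ j ] ι j ≡ i)
    ... | js , cover | yes (j , ≡.refl) = j ∷ js , λ
      { (here ≡.refl) → inj₁ (here ≡.refl)
      ; (there x∈is)  → case cover x∈is of λ { (inj₁ x∈) → inj₁ (there x∈) ; (inj₂ 0≈) → inj₂ 0≈ } }
    ... | js , cover | no ∄j = js , λ
      { (here ≡.refl) → inj₂ (f≈0 i ∄j)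
      ; (there x∈is)  → cover x∈is }

  SumsTo⇒HasSum : {I : Set} {f : I → ℝ} {s : ℝ} → SumsTo f s → HasSum f s
  SumsTo⇒HasSum {s = s} Σf ε 0<ε =
    let is , ! , lt = approach Σf (sub-lt s 0<ε)
    in is , ! , λ js !js is⊆js →
         ⇒Close (<-≤-trans lt (finiteSum-⊆ (nonneg Σf) ! is⊆js)) (≤-<-trans (bound Σf !js) (add-gt s 0<ε))

  -- A finite sum above `s` would keep every larger list away from `s` by the same excess, against
  -- convergence.
  HasSum⇒SumsTo : {I : Set} {f : I → ℝ} {s : ℝ} → (∀ i → 0# ≤ f i) → HasSum f s → SumsTo f s
  HasSum⇒SumsTo {f = f} {s} 0≤f Σf = record
    { nonneg   = 0≤f
    ; bound    = λ {js} ! → ≮⇒≥ λ s<f →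
        let is , !is , close = Σf _ (0<-slack s<f)
            ks = nub (is ++ js)
        in ≤⇒≯ (finiteSum-⊆ 0≤f ! (∈-nub ∘ ∈-++⁺ʳ is))
             (<-respʳ-≈ (add-sub s _) (proj₂ (Close⇒ (close ks (nub-! (is ++ js)) (∈-nub ∘ ∈-++⁺ˡ)))))
    ; approach = λ {y} y<s →
        let is , ! , close = Σf _ (0<-slack y<s)
        in is , ! , <-respˡ-≈ (sub-sub s y) (proj₁ (Close⇒ (close is ! id)))
    }

  the-spec : (Q : ℝ → Set) → ∃ Q → Q (the Q)
  the-spec Q ∃Q with lem (∃ Q)
  ... | yes (_ , q) = q
  ... | no  ∄Q      = ⊥-elim (∄Q ∃Q)

  ∑-sumsTo : {I : Set} {f : I → ℝ} {s : ℝ} → SumsTo f s → SumsTo f (∑ f)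
  ∑-sumsTo {f = f} Σf = HasSum⇒SumsTo (nonneg Σf) (the-spec (HasSum f) (_ , SumsTo⇒HasSum Σf))

  ∑-unique : {I : Set} {f : I → ℝ} {s : ℝ} → SumsTo f s → ∑ f ≈ s
  ∑-unique Σf = sumsTo-unique (∑-sumsTo Σf) Σf

  -- Sums over ℕ

  private
    strictUpperBound : (ns : List ℕ) → ∃[ N ] (∀ {n} → n ∈ ns → n ℕ.< N)
    strictUpperBound []       = 0 , λ ()
    strictUpperBound (m ∷ ns) = let N , ns<N = strictUpperBound ns in suc m ℕ.⊔ N , λ
      { (here ≡.refl) → ℕ.m≤m⊔n (suc m) N
      ; (there n∈ns)  → ℕ.≤-trans (ns<N n∈ns) (ℕ.m≤n⊔m (suc m) N) }

    finiteSum-≤-σ : ∀ {f} → (∀ n → 0# ≤ f n) → ∀ {ns} → Unique ns → ∃[ N ] finiteSum f ns ≤ σ N f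
    finiteSum-≤-σ {f} 0≤f {ns} ! = let N , ns<N = strictUpperBound ns in
      N , ≤-resp refl (reflexive (finiteSum-upTo f N)) (finiteSum-⊆ 0≤f ! (∈-upTo⁺ ∘ ns<N))

  σ-≤-sumsTo : ∀ {f s} → SumsTo f s → ∀ n → σ n f ≤ s
  σ-≤-sumsTo {f} Σf n = ≤-resp (reflexive (finiteSum-upTo f n)) refl (bound Σf (upTo⁺ n))

  SumsTo⇒Tends : ∀ {f s} → SumsTo f s → Tends (λ n → σ n f) s
  SumsTo⇒Tends {f} {s} Σf = mkTends
    (λ y<s → let is , ! , y<f = approach Σf y<s
                 N , f≤σ = finiteSum-≤-σ (nonneg Σf) !
             in N , λ n N≤n → <-≤-trans y<f (≤-trans f≤σ (σ-monoˡ (nonneg Σf) N≤n)))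
    (λ s<y → always λ n → ≤-<-trans (σ-≤-sumsTo Σf n) s<y)

  Tends⇒SumsTo : ∀ {f s} → (∀ n → 0# ≤ f n) → Tends (λ n → σ n f) s → SumsTo f s
  Tends⇒SumsTo {f} {s} 0≤f σ→s = record
    { nonneg   = 0≤f
    ; bound    = λ ! → let N , f≤σ = finiteSum-≤-σ 0≤f ! in ≤-trans f≤σ (σ≤s N)
    ; approach = λ y<s → let N , y<σ = above σ→s y<s in
        upTo N , upTo⁺ N , <-respʳ-≈ (reflexive (≡.sym (finiteSum-upTo f N))) (y<σ N ℕ.≤-refl)
    }
    where
    σ≤s : ∀ N → σ N f ≤ s
    σ≤s N = ≮⇒≥ λ s<σ → let M , σ<σN = below σ→s s<σ in
      ≤⇒≯ (σ-monoˡ 0≤f (ℕ.m≤m⊔n N M)) (σ<σN (N ℕ.⊔ M) (ℕ.m≤n⊔m N M))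

  sumsTo-σ-support : ∀ {f} n → (∀ k → 0# ≤ f k) → (∀ k → n ℕ.≤ k → f k ≈ 0#) → SumsTo f (σ n f)
  sumsTo-σ-support {f} n 0≤f f≈0 = sumsTo-cong (λ _ → refl) (reflexive (finiteSum-upTo f n))
    (sumsTo-support 0≤f (upTo⁺ n) supp)
    where
    supp : ∀ k → k ∈ upTo n ⊎ f k ≈ 0#
    supp k with k ℕ.<? n
    ... | yes k<n = inj₁ (∈-upTo⁺ k<n)
    ... | no  k≮n = inj₂ (f≈0 k (ℕ.≮⇒≥ k≮n))

  conv : (ℕ → ℝ) → (ℕ → ℝ) → ℕ → ℝ
  conv u g n = σ (suc n) λ k → u (n ℕ.∸ k) * g k

  -- The terms with k < M tend to p * σ M g, and the others contribute at most h - σ M g.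
  conv-tends : ∀ {u g p h} → (∀ n → 0# ≤ u n) → (∀ n → u n ≤ 1#) → Tends u p → SumsTo g h →
               Tends (conv u g) (p * h)
  conv-tends {u} {g} {p} {h} 0≤u u≤1 u→p Σg = mkTends lower upper
    where
    head : ℕ → ℕ → ℝ
    head M n = σ M λ k → u (n ℕ.∸ k) * g k

    0≤p : 0# ≤ p
    0≤p = tends-≥ u→p 0≤u

    0≤term : ∀ n k → 0# ≤ u (n ℕ.∸ k) * g k
    0≤term n k = *-nonneg (0≤u _) (nonneg Σg k)

    head-tends : ∀ M → Tends (head M) (p * σ M g)
    head-tends M = tends-cong (always λ _ → refl) (σ-* M p g)
      (tends-σ M λ k → tends-*ʳ (nonneg Σg k) (tends-∸ k u→p))

    lower : ∀ {y} → y < p * h → Eventually λ n → y < conv u g n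
    lower y<ph =
      let M , y<pσ = above (tends-*ˡ 0≤p (SumsTo⇒Tends Σg)) y<ph
          N , y<head = above (head-tends M) (y<pσ M ℕ.≤-refl)
      in M ℕ.⊔ N , λ n le → <-≤-trans (y<head n (ℕ.m⊔n≤o⇒n≤o M N le))
           (σ-monoˡ (0≤term n) (ℕ.m≤n⇒m≤1+n (ℕ.m⊔n≤o⇒m≤o M N le)))

    tail≤ : ∀ M n → M ℕ.≤ n → conv u g n ≤ head M n + (h - σ M g)
    tail≤ M n M≤n = ≤-trans (≤-reflexive split)
      (+-monoʳ-≤ (head M n) (≤-trans (σ-mono r (λ k _ → *≤1′ (nonneg Σg (M ℕ.+ k)) (u≤1 _))) rest≤))
      where
      r = suc n ℕ.∸ M
      M+r≡ : M ℕ.+ r ≡ suc n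
      M+r≡ = ℕ.m+[n∸m]≡n (ℕ.m≤n⇒m≤1+n M≤n)
      split : conv u g n ≈ head M n + σ r (λ k → u (n ℕ.∸ (M ℕ.+ k)) * g (M ℕ.+ k))
      split = trans (reflexive (≡.cong (λ m → σ m (λ k → u (n ℕ.∸ k) * g k)) (≡.sym M+r≡))) (σ-split M r _)
      rest≤ : σ r (λ k → g (M ℕ.+ k)) ≤ h - σ M g
      rest≤ = ≤-by (0≤-slack (≤-resp (σ-split M r g) refl (σ-≤-sumsTo Σg (M ℕ.+ r))))
        (solve 3 (λ h a b → h :- a :- b := h :- (a :+ b)) refl h (σ M g) _)

    bounds : Tends (λ M → p * σ M g + (h - σ M g)) (p * h)
    bounds = tends-cong (always λ _ → refl) (solve 2 (λ p h → p :* h :+ (h :- h) := p :* h) refl p h)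
      (tends-+ (tends-*ˡ 0≤p Σ→h) (tends-+ (tends-const h) (tends-neg Σ→h)))
      where Σ→h = SumsTo⇒Tends Σg

    upper : ∀ {y} → p * h < y → Eventually λ n → conv u g n < y
    upper ph<y =
      let M , lt = below bounds ph<y
          N , head< = below (tends-+ (head-tends M) (tends-const (h - σ M g))) (lt M ℕ.≤-refl)
      in M ℕ.⊔ N , λ n le → ≤-<-trans (tail≤ M n (ℕ.m⊔n≤o⇒m≤o M N le)) (head< n (ℕ.m⊔n≤o⇒n≤o M N le))

-- Closure properties of sigma-algebras

module Measurability ⦃ R : CompleteOrderedField ⦄ {Ω : Set} (F : Theory.SigmaAlgebra ⦃ R ⦄ Ω) where
  open Theory ⦃ R ⦄ hiding (zero)
  open SigmaAlgebra F

  ¬¬-elim : {A : Set} → ¬ ¬ A → A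
  ¬¬-elim {A} ¬¬a with lem A
  ... | yes a = a
  ... | no ¬a = ⊥-elim (¬¬a ¬a)

  -- Lets deterministic side conditions, such as `n ℕ.< θ`, occur inside events.
  measurable-const : (Q : Set) → Measurable (λ _ → Q)
  measurable-const Q with lem Q
  ... | yes q = resp ((λ _ → q) , (λ _ → tt)) universe
  ... | no ¬q = resp ((λ ¬u → ⊥-elim (¬u tt)) , (λ q → ⊥-elim (¬q q))) (complement universe)

  measurable-⋂ : {A : ℕ → Pred Ω 0ℓ} → (∀ n → Measurable (A n)) → Measurable (λ ω → ∀ n → A n ω)
  measurable-⋂ {A} mA = resp
    ((λ h n → ¬¬-elim λ ¬a → h (n , ¬a)) , (λ h (n , ¬a) → ¬a (h n)))
    (complement (union (∁ ∘ A) (complement ∘ mA)))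

  measurable-∩ : ∀ {A B} → Measurable A → Measurable B → Measurable (A ∩ B)
  measurable-∩ {A} {B} mA mB = resp
    ((λ h → h 0 , h 1) , (λ { (a , b) zero → a ; (a , b) (suc _) → b }))
    (measurable-⋂ {λ { zero → A ; (suc _) → B }} (λ { zero → mA ; (suc _) → mB }))

  measurable-⇒ : ∀ Q {A} → Measurable A → Measurable (λ ω → Q → A ω)
  measurable-⇒ Q mA with lem Q
  ... | yes q = resp ((λ a _ → a) , (λ h → h q)) mA
  ... | no ¬q = resp ((λ _ q → ⊥-elim (¬q q)) , (λ _ → tt)) universe

  measurable-+ : {Y W : Ω → ℕ} → (∀ n → Measurable (λ ω → Y ω ≡ n)) → (∀ n → Measurable (λ ω → W ω ≡ n)) →
                 ∀ n → Measurable (λ ω → Y ω ℕ.+ W ω ≡ n)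
  measurable-+ mY mW n = resp
    ((λ { (y , w , ≡.refl , ≡.refl , eq) → eq }) , (λ eq → _ , _ , ≡.refl , ≡.refl , eq))
    (union _ λ y → union _ λ w → measurable-∩ (mY y) (measurable-∩ (mW w) (measurable-const (y ℕ.+ w ≡ n))))

-- Countable partitions and means of integer random variables

module Measure ⦃ R : CompleteOrderedField ⦄ {Ω : Set} {F : Theory.SigmaAlgebra ⦃ R ⦄ Ω}
               (μ : Theory.ProbabilityMeasure ⦃ R ⦄ F) where
  open Theory ⦃ R ⦄ hiding (zero; ℙ)
  open RealLine ⦃ R ⦄
  open Summation ⦃ R ⦄
  open SigmaAlgebra F
  open Measurability ⦃ R ⦄ F
  open ProbabilityMeasure μ

  -- The empty event is a disjoint union of copies of itself, so twice its probability is at most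
  -- its probability.
  ℙ-⊥ : ℙ (λ _ → ⊥) ≈ 0#
  ℙ-⊥ = ≤-antisym (≤-by (0≤-slack 2p≤p) (solve 1 (λ p → con ℤ.0ℤ :- p := p :- (p :+ (p :+ con ℤ.0ℤ))) refl _))
                  (ℙ-nonneg m⊥)
    where
    m⊥ = measurable-const ⊥
    2p≤p : σ 2 (λ _ → ℙ (λ _ → ⊥)) ≤ ℙ (λ _ → ⊥)
    2p≤p = ≤-resp refl (ℙ-cong (union _ (λ _ → m⊥)) (proj₂ , λ ()))
      (σ-≤-sumsTo (Tends⇒SumsTo (λ _ → ℙ-nonneg m⊥)
        (HasSeriesSum⇒Tends (ℙ-union (λ _ _ → ⊥) (λ _ → m⊥) (λ _ _ _ → proj₁)))) 2)

  ℙ-empty : ∀ {A} → Measurable A → (∀ ω → ¬ A ω) → ℙ A ≈ 0#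
  ℙ-empty mA ∄A = trans (ℙ-cong mA ((λ {ω} a → ∄A ω a) , λ ())) ℙ-⊥

  ℙ-partition : {J : Set} → J ↣ ℕ → {A : J → Pred Ω 0ℓ} {B : Pred Ω 0ℓ} → (∀ j → Measurable (A j)) →
                (∀ {j k ω} → A j ω → A k ω → j ≡ k) → (∀ {ω} → B ω → ∃[ j ] A j ω) → (∀ {j ω} → A j ω → B ω) →
                SumsTo (ℙ ∘ A) (ℙ B)
  ℙ-partition {J} code {A} {B} mA disjoint B⊆ ⊆B = sumsTo-cong at-code (ℙ-cong (union A′ mA′) (A′⊆B , B⊆A′))
    (sumsTo-restrict to injective off-code (Tends⇒SumsTo (ℙ-nonneg ∘ mA′)
      (HasSeriesSum⇒Tends (ℙ-union A′ mA′ disjoint′))))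
    where
    open Injection code using (to; injective)

    -- Numbers that are not codes receive the empty event, so additivity over all of ℕ applies.
    A′ : ℕ → Pred Ω 0ℓ
    A′ n ω = ∃[ j ] to j ≡ n × A j ω

    mA′ : ∀ n → Measurable (A′ n)
    mA′ n with lem (∃[ j ] to j ≡ n)
    ... | yes (j , ≡.refl) = resp ((λ a → j , ≡.refl , a) , λ { (k , eq , a) → ≡.subst (λ j → A j _) (injective eq) a }) (mA j)
    ... | no ∄j = resp (⊥-elim , λ (j , eq , _) → ∄j (j , eq)) (measurable-const ⊥)

    disjoint′ : ∀ m n → m ≢ n → ∀ {ω} → (A′ m ∩ A′ n) ω → ⊥
    disjoint′ m n m≢n ((j , ≡.refl , a) , (k , ≡.refl , b)) = m≢n (≡.cong to (disjoint a b))

    A′⊆B : ∀ {ω} → ⋃ ℕ A′ ω → B ω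
    A′⊆B (_ , _ , _ , a) = ⊆B a

    B⊆A′ : ∀ {ω} → B ω → ⋃ ℕ A′ ω
    B⊆A′ b = let j , a = B⊆ b in to j , j , ≡.refl , a

    at-code : ∀ j → ℙ (A′ (to j)) ≈ ℙ (A j)
    at-code j = ℙ-cong (mA′ (to j))
      ((λ { (k , eq , a) → ≡.subst (λ j → A j _) (injective eq) a }) , (λ a → j , ≡.refl , a))

    off-code : ∀ n → ¬ (∃[ j ] to j ≡ n) → ℙ (A′ n) ≈ 0#
    off-code n ∄j = ℙ-empty (mA′ n) λ { _ (j , eq , _) → ∄j (j , eq) }

  ℙ-by-value : {V : Set} → V ↣ ℕ → {Y : Ω → V} {B : Pred Ω 0ℓ} → (∀ v → Measurable (λ ω → Y ω ≡ v)) →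
               Measurable B → SumsTo (λ v → ℙ (λ ω → B ω × Y ω ≡ v)) (ℙ B)
  ℙ-by-value code mY mB = ℙ-partition code (λ v → measurable-∩ mB (mY v))
    (λ { (_ , ≡.refl) (_ , ≡.refl) → ≡.refl }) (λ b → _ , b , ≡.refl) proj₁

  ℙ-split : ∀ {A B} → Measurable A → Measurable B → ℙ B ≈ ℙ (B ∩ A) + ℙ (B ∩ ∁ A)
  ℙ-split {A} {B} mA mB = trans
    (sumsTo-unique (ℙ-partition bool {C} mC (λ {j} {k} → disjoint j k) cover (λ {j} → inside j))
      (sumsTo-support (ℙ-nonneg ∘ mC) ((( λ ()) All.∷ All.[]) ∷ (All.[] ∷ [])) exhaustive))
    (+-congˡ (+-identityʳ _))
    where
    bool : Bool ↣ ℕ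
    bool = mk↣ {to = λ { true → 0 ; false → 1 }}
      λ { {true} {true} _ → ≡.refl ; {false} {false} _ → ≡.refl ; {true} {false} () ; {false} {true} () }

    C : Bool → Pred Ω 0ℓ
    C true  = B ∩ A
    C false = B ∩ ∁ A

    mC : ∀ b → Measurable (C b)
    mC true  = measurable-∩ mB mA
    mC false = measurable-∩ mB (complement mA)

    disjoint : ∀ j k {ω} → C j ω → C k ω → j ≡ k
    disjoint true  true  _ _ = ≡.refl
    disjoint false false _ _ = ≡.refl
    disjoint true  false (_ , a) (_ , ¬a) = ⊥-elim (¬a a)
    disjoint false true  (_ , ¬a) (_ , a) = ⊥-elim (¬a a)

    inside : ∀ j {ω} → C j ω → B ω
    inside true  = proj₁
    inside false = proj₁

    cover : ∀ {ω} → B ω → ∃[ j ] C j ω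
    cover {ω} b with lem (A ω)
    ... | yes a = true , b , a
    ... | no ¬a = false , b , ¬a

    exhaustive : ∀ b → _ ⊎ _
    exhaustive true  = inj₁ (here ≡.refl)
    exhaustive false = inj₁ (there (here ≡.refl))

  ℙ-mono : ∀ {A B} → Measurable A → Measurable B → (∀ {ω} → A ω → B ω) → ℙ A ≤ ℙ B
  ℙ-mono {A} {B} mA mB A⊆B = ≤-resp (ℙ-cong (measurable-∩ mB mA) (proj₂ , λ a → A⊆B a , a)) (sym (ℙ-split mA mB))
    (x≤x+y (ℙ-nonneg (measurable-∩ mB (complement mA))))

  ℙ-∖ : ∀ {A B} → Measurable A → Measurable B → (∀ {ω} → A ω → B ω) → ℙ (B ∩ ∁ A) ≈ ℙ B - ℙ A
  ℙ-∖ {A} {B} mA mB A⊆B = trans (solve 2 (λ a d → d := a :+ d :- a) refl (ℙ A) _)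
    (+-congʳ (trans (+-congʳ (ℙ-cong mA ((λ a → A⊆B a , a) , proj₂))) (sym (ℙ-split mA mB))))

  -- The expectation of `Y` over the event `A`, written through the law of `Y` so that it stays a
  -- sum of nonnegative terms.
  ℙ-mean : (Ω → ℕ) → Pred Ω 0ℓ → ℝ → Set
  ℙ-mean Y A e = SumsTo (λ n → fromℕ n * ℙ (λ ω → A ω × Y ω ≡ n)) e

  ℕ↣ℕ : ℕ ↣ ℕ
  ℕ↣ℕ = ↣-id ℕ

  -- Change of variables: on `A` the joint law of `W` and `Y` lives on the graph of `φ`, so each row
  -- of the double sum has a single possibly nonzero term, while its columns give the law of `Y`.
  mean-function : {Y W : Ω → ℕ} {A : Pred Ω 0ℓ} {e : ℝ} (φ : ℕ → ℕ) → (∀ n → Measurable (λ ω → Y ω ≡ n)) →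
                  (∀ n → Measurable (λ ω → W ω ≡ n)) → Measurable A → (∀ {ω} → A ω → Y ω ≡ φ (W ω)) →
                  SumsTo (λ w → fromℕ (φ w) * ℙ (λ ω → A ω × W ω ≡ w)) e → ℙ-mean Y A e
  mean-function {Y} {W} {A} φ mY mW mA Y≡φW = tonelli
    (λ w → sumsTo-cong (λ _ → refl) (row w) (sumsTo-support (nonneg′ w) {φ w ∷ []} (All.[] ∷ []) (supp w)))
    (λ n → sumsTo-* (fromℕ-nonneg n) (ℙ-by-value ℕ↣ℕ mW (measurable-∩ mA (mY n))))
    where
    joint : ℕ → ℕ → Pred Ω 0ℓ
    joint w n ω = (A ω × Y ω ≡ n) × W ω ≡ w

    mjoint : ∀ w n → Measurable (joint w n)
    mjoint w n = measurable-∩ (measurable-∩ mA (mY n)) (mW w)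

    nonneg′ : ∀ w n → 0# ≤ fromℕ n * ℙ (joint w n)
    nonneg′ w n = *-nonneg (fromℕ-nonneg n) (ℙ-nonneg (mjoint w n))

    supp : ∀ w n → _ ⊎ fromℕ n * ℙ (joint w n) ≈ 0#
    supp w n with n ℕ.≟ φ w
    ... | yes n≡φw = inj₁ (here n≡φw)
    ... | no  n≢φw = inj₂ (trans (*-congˡ (ℙ-empty (mjoint w n)
      λ { _ ((a , ≡.refl) , ≡.refl) → n≢φw (Y≡φW a) })) (zeroʳ _))

    row : ∀ w → fromℕ (φ w) * ℙ (joint w (φ w)) + 0# ≈ fromℕ (φ w) * ℙ (λ ω → A ω × W ω ≡ w)
    row w = trans (+-identityʳ _) (*-congˡ (ℙ-cong (mjoint w (φ w))
      ((λ ((a , _) , eq) → a , eq) , (λ (a , eq) → (a , ≡.trans (Y≡φW a) (≡.cong φ eq)) , eq))))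

  -- The joint law is summed over the values of Y, on each of which Y + W is a function of W.
  mean-+ : {Y W : Ω → ℕ} {d e : ℝ} → (∀ n → Measurable (λ ω → Y ω ≡ n)) → (∀ n → Measurable (λ ω → W ω ≡ n)) →
           ℙ-mean Y U d → ℙ-mean W U e → ℙ-mean (λ ω → Y ω ℕ.+ W ω) U (d + e)
  mean-+ {Y} {W} mY mW EY EW = tonelli
    (λ y → sumsTo-cong (λ n → *-congˡ (ℙ-cong (measurable-∩ (mUY y) (measurable-+ mY mW n)) (swap , swap))) refl
      (mean-function {W = W} (y ℕ.+_) (measurable-+ mY mW) mW (mUY y) (λ { (_ , ≡.refl) → ≡.refl })
        (sumsTo-cong (λ w → sym (trans (*-congʳ (fromℕ-homo y w)) (distribʳ _ _ _))) refl
          (sumsTo-+ (sumsTo-* (fromℕ-nonneg y) (ℙ-by-value ℕ↣ℕ mW (mUY y))) (proj₂ (slice y))))))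
    (λ n → sumsTo-* (fromℕ-nonneg n) (ℙ-by-value ℕ↣ℕ mY (measurable-∩ universe (measurable-+ mY mW n))))
    (sumsTo-+ EY (tonelli
      (λ w → sumsTo-* (fromℕ-nonneg w) (ℙ-by-value ℕ↣ℕ mY (measurable-∩ universe (mW w))))
      (λ y → sumsTo-cong (λ w → *-congˡ (ℙ-cong (measurable-∩ (mUY y) (mW w)) (swap , swap))) refl (proj₂ (slice y)))
      EW))
    where
    swap : {A B C : Set} → (A × B) × C → (A × C) × B
    swap ((a , b) , c) = (a , c) , b

    mUY : ∀ y → Measurable (λ ω → U ω × Y ω ≡ y)
    mUY y = measurable-∩ universe (mY y)

    -- The mean of `W` over the event that `Y` is `y` exists because it is dominated by the full
    -- mean.
    slice : ∀ y → ∃ (ℙ-mean W (λ ω → U ω × Y ω ≡ y))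
    slice y = sumsTo-dominated
      (λ w → *-nonneg (fromℕ-nonneg w) (ℙ-nonneg (measurable-∩ (mUY y) (mW w))))
      (λ w → *-monoʳ-≤ (fromℕ-nonneg w) (ℙ-mono (measurable-∩ (mUY y) (mW w)) (measurable-∩ universe (mW w))
        (λ ((u , _) , eq) → u , eq)))
      EW

  sum : ∀ {n} → (Fin n → Ω → ℕ) → Ω → ℕ
  sum Y ω = Vector.foldr ℕ._+_ 0 (λ s → Y s ω)

  measurable-sum : ∀ {n} {Y : Fin n → Ω → ℕ} → (∀ s m → Measurable (λ ω → Y s ω ≡ m)) →
                   ∀ m → Measurable (λ ω → sum Y ω ≡ m)
  measurable-sum {zero}  mY m = measurable-const (0 ≡ m)
  measurable-sum {suc n} {Y} mY = measurable-+ (mY Fin.zero) (measurable-sum {Y = λ s → Y (Fin.suc s)} (mY ∘ Fin.suc))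

  mean-sum : ∀ {n} {Y : Fin n → Ω → ℕ} {e} → (∀ s m → Measurable (λ ω → Y s ω ≡ m)) →
             (∀ s → ℙ-mean (Y s) U e) → ℙ-mean (sum Y) U (fromℕ n * e)
  mean-sum {zero} {e = e} mY EY = sumsTo-cong zeros (sym (zeroˡ e)) sumsTo-0
    where
    zeros : ∀ m → 0# ≈ fromℕ m * ℙ (λ ω → U ω × 0 ≡ m)
    zeros zero    = sym (zeroˡ _)
    zeros (suc m) = sym (trans (*-congˡ (ℙ-empty (measurable-const _) λ { _ () })) (zeroʳ _))
  mean-sum {suc n} {Y} {e} mY EY = sumsTo-cong (λ _ → refl)
    (trans (+-congʳ (sym (*-identityˡ e))) (sym (distribʳ e 1# (fromℕ n))))
    (mean-+ (mY Fin.zero) (measurable-sum {Y = Y′} (mY ∘ Fin.suc))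
            (EY Fin.zero) (mean-sum {Y = Y′} (mY ∘ Fin.suc) (EY ∘ Fin.suc)))
    where
    Y′ : Fin n → Ω → ℕ
    Y′ s = Y (Fin.suc s)

-- First-passage decomposition at the state `i`

module FirstPassage ⦃ R : CompleteOrderedField ⦄ {S : Set} (P : S → S → Theory.ℝ ⦃ R ⦄)
                    (stochastic : Theory.IsStochastic ⦃ R ⦄ P) (i : S) where
  open Theory ⦃ R ⦄ hiding (zero)
  open RealLine ⦃ R ⦄
  open Summation ⦃ R ⦄
  private module P = IsStochastic stochastic

  P-sumsTo : ∀ j → SumsTo (P j) 1#
  P-sumsTo j = HasSum⇒SumsTo (P.nonneg j) (P.row-sum j)

  -- Values in the unit interval make every average over a row of `P` converge, so `∑` does not fall
  -- back on its default value.
  Bounded : (S → ℝ) → Set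
  Bounded h = ∀ l → 0# ≤ h l × h l ≤ 1#

  average : (S → ℝ) → S → ℝ
  average h j = ∑ λ l → P j l * h l

  average-sumsTo : ∀ {h} → Bounded h → ∀ j → SumsTo (λ l → P j l * h l) (average h j)
  average-sumsTo h∈ j = ∑-sumsTo (proj₂ (sumsTo-dominated
    (λ l → *-nonneg (P.nonneg j l) (proj₁ (h∈ l))) (λ l → *≤1 (P.nonneg j l) (proj₂ (h∈ l))) (P-sumsTo j)))

  average-bounded : ∀ {h} → Bounded h → Bounded (average h)
  average-bounded h∈ j = bound (average-sumsTo h∈ j) {[]} []
                       , sumsTo-mono (λ l → *≤1 (P.nonneg j l) (proj₂ (h∈ l))) (average-sumsTo h∈ j) (P-sumsTo j)

  indicator-true : ∀ {A} → A → indicator A ≈ 1#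
  indicator-true {A} a with lem A
  ... | yes _ = refl
  ... | no ¬a = ⊥-elim (¬a a)

  indicator-false : ∀ {A} → ¬ A → indicator A ≈ 0#
  indicator-false {A} ¬a with lem A
  ... | yes a = ⊥-elim (¬a a)
  ... | no  _ = refl

  indicator-bounded : ∀ A → 0# ≤ indicator A × indicator A ≤ 1#
  indicator-bounded A with lem A
  ... | yes _ = 0≤1 , ≤-refl
  ... | no  _ = ≤-refl , 0≤1

  power-bounded : ∀ t l → Bounded (λ j → power P t j l)
  power-bounded zero    l j = indicator-bounded (j ≡ l)
  power-bounded (suc t) l   = average-bounded (power-bounded t l)

  hit : ℕ → S → ℝ
  hit t j = power P t j i

  u : ℕ → ℝ
  u t = hit t i

  off : S → ℝ
  off l = indicator (l ≢ i)

  -- Built from `P` by first-step analysis, without reference to the chain; `off` kills the paths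
  -- that step to `i`. The link with the law of the chain is `taboo`.
  g : ℕ → S → ℝ
  g zero    j = 1#
  g (suc n) j = average (λ l → off l * g n l) j

  *-bounded : ∀ {h k} → Bounded h → Bounded k → Bounded (λ l → h l * k l)
  *-bounded h∈ k∈ l = *-nonneg (proj₁ (h∈ l)) (proj₁ (k∈ l))
                    , ≤-trans (*≤1 (proj₁ (h∈ l)) (proj₂ (k∈ l))) (proj₂ (h∈ l))

  off-bounded : Bounded off
  off-bounded l = indicator-bounded (l ≢ i)

  g-bounded : ∀ n → Bounded (g n)
  g-bounded zero    j = 0≤1 , ≤-refl
  g-bounded (suc n)   = average-bounded (*-bounded off-bounded (g-bounded n))

  g-suc : ∀ n j → SumsTo (λ l → P j l * (off l * g n l)) (g (suc n) j)
  g-suc n = average-sumsTo (*-bounded off-bounded (g-bounded n))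

  hit-suc : ∀ n j → SumsTo (λ l → P j l * hit n l) (hit (suc n) j)
  hit-suc n = average-sumsTo (power-bounded n i)

  u0≈1 : u 0 ≈ 1#
  u0≈1 = indicator-true ≡.refl

  private
    C : ℕ → S → ℝ
    C n j = conv u (λ m → g m j) n

  -- The visits to i up to time n are counted from the first one on.
  visits-after-step : ∀ n j → σ n (λ t → hit (suc t) j) + C n j ≈ σ (suc n) u
  visits              : ∀ n l → σ (suc n) (λ t → hit t l) + off l * C n l ≈ σ (suc n) u

  visits n l = by-cases (lem (l ≡ i))
    where
    open ≈-Reasoning
    by-cases : Dec (l ≡ i) → σ (suc n) (λ t → hit t l) + off l * C n l ≈ σ (suc n) u
    by-cases (yes ≡.refl) = trans (+-congˡ (trans (*-congʳ (indicator-false λ i≢i → i≢i ≡.refl)) (zeroˡ _))) (+-identityʳ _)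
    -- Away from `i` the time 0 contributes no visit, so the count may start at time 1.
    by-cases (no l≢i)     = begin
      hit 0 l + σ n (λ t → hit (suc t) l) + off l * C n l   ≈⟨ +-cong (+-congʳ (indicator-false l≢i)) (*-congʳ (indicator-true l≢i)) ⟩
      0# + σ n (λ t → hit (suc t) l) + 1# * C n l           ≈⟨ +-cong (+-identityˡ _) (*-identityˡ _) ⟩
      σ n (λ t → hit (suc t) l) + C n l                     ≈⟨ visits-after-step n l ⟩
      σ (suc n) u                                           ∎

  visits-after-step zero    j = trans (+-identityˡ _) (+-congʳ (*-identityʳ _))
  -- The term `k = 0` of the convolution is `u (suc n)`, since `g 0` is 1. The rest is the average
  -- of `visits n` over the first step from `j`, whose right-hand side does not depend on the state
  -- reached.
  visits-after-step (suc n) j = begin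
    σ (suc n) (λ t → hit (suc t) j) + (u (suc n) * 1# + shifted)   ≈⟨ solve 3 (λ a b c → a :+ (b :* con ℤ.1ℤ :+ c) := a :+ c :+ b) refl _ _ _ ⟩
    σ (suc n) (λ t → hit (suc t) j) + shifted + u (suc n)          ≈⟨ +-congʳ (sumsTo-unique averaged total) ⟩
    σ (suc n) u + u (suc n)                                        ≈⟨ σ-last (suc n) u ⟨
    σ (suc (suc n)) u                                              ∎
    where
    open ≈-Reasoning
    shifted = σ (suc n) λ k → u (n ℕ.∸ k) * g (suc k) j

    total : SumsTo (λ l → P j l * σ (suc n) u) (σ (suc n) u)
    total = sumsTo-cong (λ l → *-comm _ _) (*-identityʳ _)
      (sumsTo-* (σ-nonneg (suc n) (λ t → proj₁ (power-bounded t i i))) (P-sumsTo j))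

    regroup : ∀ l → σ (suc n) (λ k → u (n ℕ.∸ k) * (P j l * (off l * g k l))) ≈ P j l * (off l * C n l)
    regroup l = begin
      σ (suc n) (λ k → u (n ℕ.∸ k) * (P j l * (off l * g k l)))
        ≈⟨ σ-cong (suc n) (λ k _ → solve 4 (λ a b c d → a :* (b :* (c :* d)) := (b :* c) :* (a :* d)) refl (u (n ℕ.∸ k)) (P j l) (off l) (g k l)) ⟩
      σ (suc n) (λ k → (P j l * off l) * (u (n ℕ.∸ k) * g k l))
        ≈⟨ σ-* (suc n) (P j l * off l) (λ k → u (n ℕ.∸ k) * g k l) ⟩
      (P j l * off l) * C n l
        ≈⟨ *-assoc _ _ _ ⟩
      P j l * (off l * C n l) ∎

    averaged : SumsTo (λ l → P j l * σ (suc n) u) (σ (suc n) (λ t → hit (suc t) j) + shifted)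
    averaged = sumsTo-cong
      (λ l → trans (+-cong (σ-* (suc n) (P j l) (λ t → hit t l)) (regroup l))
                   (trans (sym (distribˡ _ _ _)) (*-congˡ (visits n l))))
      refl
      (sumsTo-+ (sumsTo-σ (suc n) (λ t → hit-suc t j))
                (sumsTo-σ (suc n) (λ k → sumsTo-* (proj₁ (power-bounded (n ℕ.∸ k) i i)) (g-suc k j))))

  -- Started at `i`, the visits after time 0 cancel in `visits-after-step`. In probabilistic terms
  -- the summands distribute the certain event over the time `n - k` of the last visit to `i` up to
  -- time `n`.
  conv-return : ∀ n → C n i ≈ 1#
  conv-return n = begin
    C n i                                       ≈⟨ solve 2 (λ a c → c := a :+ c :- a) refl (σ n (u ∘ suc)) (C n i) ⟩
    σ n (u ∘ suc) + C n i - σ n (u ∘ suc)       ≈⟨ +-congʳ (visits-after-step n i) ⟩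
    u 0 + σ n (u ∘ suc) - σ n (u ∘ suc)         ≈⟨ solve 2 (λ a c → c :+ a :- a := c) refl (σ n (u ∘ suc)) (u 0) ⟩
    u 0                                         ≈⟨ u0≈1 ⟩
    1#                                          ∎
    where open ≈-Reasoning

  conv-hit : ∀ {l} → l ≢ i → ∀ n → C n l ≈ σ (suc n) u - σ (suc n) (λ t → hit t l)
  conv-hit {l} l≢i n = begin
    C n l                                        ≈⟨ *-identityˡ _ ⟨
    1# * C n l                                   ≈⟨ *-congʳ (indicator-true l≢i) ⟨
    off l * C n l                                ≈⟨ solve 2 (λ a c → c := a :+ c :- a) refl V (off l * C n l) ⟩
    V + off l * C n l - V                        ≈⟨ +-congʳ (visits n l) ⟩
    σ (suc n) u - V                              ∎
    where
    open ≈-Reasoning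
    V = σ (suc n) (λ t → hit t l)

  module _ (π : S → ℝ) (converges : ∀ j → SeriesConverges (λ t → power P t j i - π i)) where

    -- Convergence rules out the default value of `∑∞`.
    Z-tends : ∀ j → Tends (λ n → σ n (λ t → hit t j - π i)) (Z P π j i)
    Z-tends j = HasSeriesSum⇒Tends (the-spec (HasSeriesSum (λ t → hit t j - π i)) (converges j))

    -- Consecutive partial sums of the series for `Z P π i i` have the same limit and differ by
    -- `u n - π i`.
    u-tends : Tends u (π i)
    u-tends = tends-cong
      (always λ n → trans (+-congʳ (trans (+-congʳ (σ-last n _)) (solve 2 (λ a b → a :+ b :- a := b) refl _ _)))
                          (solve 2 (λ a p → a :- p :+ p := a) refl (u n) (π i)))
      (solve 2 (λ z p → z :- z :+ p := p) refl (Z P π i i) (π i))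
      (tends-+ (tends-+ (tends-suc (Z-tends i)) (tends-neg (Z-tends i))) (tends-const (π i)))

    σ-cancel : ∀ n (x y : ℕ → ℝ) p → σ n (λ t → x t - p) - σ n (λ t → y t - p) ≈ σ n x - σ n y
    σ-cancel zero    x y p = refl
    σ-cancel (suc n) x y p = begin
      (x 0 - p + X′) - (y 0 - p + Y′)    ≈⟨ solve 5 (λ a b c d p → (a :- p :+ c) :- (b :- p :+ d) := (a :- b) :+ (c :- d)) refl (x 0) (y 0) X′ Y′ p ⟩
      (x 0 - y 0) + (X′ - Y′)            ≈⟨ +-congˡ (σ-cancel n (x ∘ suc) (y ∘ suc) p) ⟩
      (x 0 - y 0) + (X″ - Y″)            ≈⟨ solve 4 (λ a b c d → (a :- b) :+ (c :- d) := (a :+ c) :- (b :+ d)) refl (x 0) (y 0) X″ Y″ ⟩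
      (x 0 + X″) - (y 0 + Y″)            ∎
      where
      open ≈-Reasoning
      X′ = σ n (λ t → x (suc t) - p)
      Y′ = σ n (λ t → y (suc t) - p)
      X″ = σ n (x ∘ suc)
      Y″ = σ n (y ∘ suc)

    -- The centring by `π i` cancels when the partial sums for `i` and `l` are subtracted, leaving
    -- the difference of `conv-hit`.
    conv-hit-tends : ∀ {l} → l ≢ i → Tends (λ n → C n l) (Z P π i i - Z P π l i)
    conv-hit-tends {l} l≢i = tends-cong
      (always λ n → trans (σ-cancel (suc n) u (λ t → hit t l) (π i)) (sym (conv-hit l≢i n))) refl
      (tends-+ (tends-suc (Z-tends i)) (tends-neg (tends-suc (Z-tends l))))

    u-conv-tends : ∀ {h H} → SumsTo h H → Tends (conv u h) (π i * H)
    u-conv-tends = conv-tends (λ t → proj₁ (power-bounded t i i)) (λ t → proj₂ (power-bounded t i i)) u-tends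

    -- Kac's formula: the convolution is constantly 1, and it also tends to `π i * μ`.
    π*mean-return : ∀ {μ} → SumsTo (λ m → g m i) μ → π i * μ ≈ 1#
    π*mean-return Σg = tends-unique (u-conv-tends Σg)
      (tends-cong (always λ n → sym (conv-return n)) refl (tends-const 1#))

    -- The weight c covers states l with an infinite mean hitting time.
    π*mean-hit : ∀ {c l H} → 0# ≤ c → l ≢ i → SumsTo (λ m → c * g m l) H → c * (Z P π i i - Z P π l i) ≈ π i * H
    π*mean-hit {c} {l} 0≤c l≢i Σcg = tends-unique (tends-*ˡ 0≤c (conv-hit-tends l≢i))
      (tends-cong (always λ n → trans
        (σ-cong (suc n) (λ k _ → solve 3 (λ u c g → u :* (c :* g) := c :* (u :* g)) refl (u (n ℕ.∸ k)) c (g k l)))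
        (σ-* (suc n) c λ k → u (n ℕ.∸ k) * g k l)) refl (u-conv-tends Σcg))

-- Infima of sets of times and truncation

module Infimum ⦃ R : CompleteOrderedField ⦄ where
  open Theory ⦃ R ⦄ hiding (zero)

  least-element : (A : Pred ℕ 0ℓ) → ∀ n → A n → ∃ (IsLeast A)
  least-element A = <-rec (λ n → A n → ∃ (IsLeast A)) step
    where
    step : ∀ n → (∀ {m} → m ℕ.< n → A m → ∃ (IsLeast A)) → A n → ∃ (IsLeast A)
    step n rec a with lem (∃[ m ] m ℕ.< n × A m)
    ... | yes (m , m<n , a′) = rec m<n a′
    ... | no  none           = n , a , λ m a′ → ℕ.≮⇒≥ λ m<n → none (m , m<n , a′)

  <inf⇒∉ : ∀ {A n} → [ n ] <⁺ inf A → ∀ {m} → m ℕ.≤ n → ¬ A m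
  <inf⇒∉ {A} lt {m} m≤n a with lem (∃ (IsLeast A))
  <inf⇒∉ {A} [ n<l ] {m} m≤n a | yes (l , _ , l≤) = ℕ.<⇒≱ n<l (ℕ.≤-trans (l≤ m a) m≤n)
  <inf⇒∉ {A} _ {m} m≤n a       | no  ∄l            = ∄l (least-element A m a)

  ∉⇒<inf : ∀ {A n} → (∀ {m} → m ℕ.≤ n → ¬ A m) → [ n ] <⁺ inf A
  ∉⇒<inf {A} {n} h with lem (∃ (IsLeast A))
  ... | yes (l , a , _) = [ ℕ.≰⇒> (λ l≤n → h l≤n a) ]
  ... | no  _           = [ n ]<⊤⁺

  <truncate⇒ : ∀ {θ n} t → n ℕ.< truncate θ t → n ℕ.< θ × [ n ] <⁺ t
  <truncate⇒ {θ} [ m ] n<m⊓θ = ℕ.m<n⊓o⇒m<o m θ n<m⊓θ , [ ℕ.m<n⊓o⇒m<n m θ n<m⊓θ ]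
  <truncate⇒     ⊤⁺    n<θ   = n<θ , [ _ ]<⊤⁺

  ⇒<truncate : ∀ {θ n} t → n ℕ.< θ → [ n ] <⁺ t → n ℕ.< truncate θ t
  ⇒<truncate [ m ] n<θ [ n<m ] = ℕ.⊓-glb n<m n<θ
  ⇒<truncate ⊤⁺    n<θ _       = n<θ

  finite⇒ : ∀ {n} {t : ℕ ⁺} → t ≡ [ suc n ] → [ n ] <⁺ t × ¬ ([ suc n ] <⁺ t)
  finite⇒ ≡.refl = [ ℕ.n<1+n _ ] , λ { [ lt ] → ℕ.<-irrefl ≡.refl lt }

  ⇒finite : ∀ {n} {t : ℕ ⁺} → [ n ] <⁺ t → ¬ ([ suc n ] <⁺ t) → t ≡ [ suc n ]
  ⇒finite [ n<m ]    ≮ = ≡.cong [_] (ℕ.≤-antisym (ℕ.≮⇒≥ λ lt → ≮ [ lt ]) n<m)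
  ⇒finite [ n ]<⊤⁺   ≮ = ⊥-elim (≮ [ suc n ]<⊤⁺)

-- Means as sums of tail probabilities

module Tail ⦃ R : CompleteOrderedField ⦄ where
  open Theory ⦃ R ⦄ hiding (zero)
  open RealLine ⦃ R ⦄
  open Summation ⦃ R ⦄

  -- Summation by parts with its boundary term kept, because that term is estimated separately. The
  -- value `p 0` is free, as its weight is 0.
  abel : ∀ (p : ℕ → ℝ) {c} → (∀ n → p (suc n) ≈ c n - c (suc n)) →
         ∀ n → σ (suc n) (λ k → fromℕ k * p k) ≈ σ n c - fromℕ n * c n
  abel p {c} p≈ zero = solve 2 (λ p c → con ℤ.0ℤ :* p :+ con ℤ.0ℤ := con ℤ.0ℤ :- con ℤ.0ℤ :* c) refl (p 0) (c 0)
  abel p {c} p≈ (suc n) = begin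
    σ (suc (suc n)) (λ k → fromℕ k * p k)
      ≈⟨ σ-last (suc n) (λ k → fromℕ k * p k) ⟩
    σ (suc n) (λ k → fromℕ k * p k) + fromℕ (suc n) * p (suc n)
      ≈⟨ +-cong (abel p p≈ n) (*-congˡ (p≈ n)) ⟩
    (σ n c - fromℕ n * c n) + fromℕ (suc n) * (c n - c (suc n))
      ≈⟨ solve 4 (λ s m a b → (s :- m :* a) :+ (con ℤ.1ℤ :+ m) :* (a :- b) := (s :+ a) :- (con ℤ.1ℤ :+ m) :* b) refl (σ n c) (fromℕ n) (c n) (c (suc n)) ⟩
    (σ n c + c n) - fromℕ (suc n) * c (suc n)
      ≈⟨ +-congʳ (σ-last n c) ⟨
    σ (suc n) c - fromℕ (suc n) * c (suc n) ∎
    where open ≈-Reasoning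

  σ-tail-≥ : ∀ {c : ℕ → ℝ} → (∀ n → c (suc n) ≤ c n) → ∀ m k → fromℕ k * c (m ℕ.+ k) ≤ σ k (λ j → c (m ℕ.+ j))
  σ-tail-≥ {c} c↓ m zero    = ≤-reflexive (zeroˡ _)
  σ-tail-≥ {c} c↓ m (suc k) = begin
    fromℕ (suc k) * c (m ℕ.+ suc k)              ≤⟨ *-monoʳ-≤ (fromℕ-nonneg (suc k)) (≤-resp (reflexive (≡.cong c (≡.sym (ℕ.+-suc m k)))) refl (c↓ (m ℕ.+ k))) ⟩
    fromℕ (suc k) * c (m ℕ.+ k)                  ≈⟨ solve 2 (λ n c → (con ℤ.1ℤ :+ n) :* c := n :* c :+ c) refl (fromℕ k) (c (m ℕ.+ k)) ⟩
    fromℕ k * c (m ℕ.+ k) + c (m ℕ.+ k)          ≤⟨ +-monoˡ-≤ _ (σ-tail-≥ c↓ m k) ⟩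
    σ k (λ j → c (m ℕ.+ j)) + c (m ℕ.+ k)        ≈⟨ σ-last k (λ j → c (m ℕ.+ j)) ⟨
    σ (suc k) (λ j → c (m ℕ.+ j))                ∎
    where open ≤-Reasoning

  -- The boundary term of `abel` is nonnegative, so the partial means lie below the partial tail
  -- sums. For the converse, `n` is fixed and the boundary term at `n + k` is split: the part with
  -- factor `k` is absorbed by the `k` tails after `n`, and the part with factor `n` vanishes as `k`
  -- grows.
  mean-by-tails : ∀ {p c : ℕ → ℝ} {m : ℝ} → (∀ n → p (suc n) ≈ c n - c (suc n)) → (∀ n → c (suc n) ≤ c n) →
                  (∀ n → 0# ≤ c n) → Tends c 0# → SumsTo (λ n → fromℕ n * p n) m → SumsTo c m
  mean-by-tails {p} {c} {m} p≈ c↓ 0≤c c→0 Σp = Tends⇒SumsTo 0≤c (mkTends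
    (λ y<m → eventually-map (λ n y<σ → <-≤-trans y<σ (head≤ n)) (above partial y<m))
    (λ m<y → always λ n → ≤-<-trans (σ≤m n) m<y))
    where
    partial : Tends (λ n → σ (suc n) (λ k → fromℕ k * p k)) m
    partial = tends-suc (SumsTo⇒Tends Σp)

    head≤ : ∀ n → σ (suc n) (λ k → fromℕ k * p k) ≤ σ n c
    head≤ n = ≤-by (*-nonneg (fromℕ-nonneg n) (0≤c n))
      (trans (+-congˡ (-‿cong (abel p p≈ n))) (solve 2 (λ s t → s :- (s :- t) := t) refl (σ n c) _))

    σ≤m : ∀ n → σ n c ≤ m
    σ≤m n = ≤-resp refl (trans (+-congˡ (zeroʳ _)) (+-identityʳ m))
      (tends-≥ (tends-+ (tends-shift n partial) (tends-*ˡ (fromℕ-nonneg n) (tends-shift n c→0))) λ k →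
        ≤-by (0≤-slack (σ-tail-≥ c↓ n k)) (slack k))
      where
      slack : ∀ k → (σ (suc (n ℕ.+ k)) (λ j → fromℕ j * p j) + fromℕ n * c (n ℕ.+ k)) - σ n c ≈
                    σ k (λ j → c (n ℕ.+ j)) - fromℕ k * c (n ℕ.+ k)
      slack k = trans (+-congʳ (+-congʳ (trans (abel p p≈ (n ℕ.+ k))
          (+-cong (σ-split n k c) (-‿cong (*-congʳ (fromℕ-homo n k)))))))
        (solve 5 (λ s t n k c → s :+ t :- (n :+ k) :* c :+ n :* c :- s := t :- k :* c) refl
          (σ n c) _ (fromℕ n) (fromℕ k) (c (n ℕ.+ k)))

  sumsTo-drop : ∀ {f s} k → SumsTo f s → SumsTo (λ n → f (k ℕ.+ n)) (s - σ k f)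
  sumsTo-drop {f} {s} k Σf = Tends⇒SumsTo (λ n → nonneg Σf (k ℕ.+ n))
    (tends-cong (always λ n → trans (+-congʳ (σ-split k n f)) (solve 2 (λ a b → a :+ b :- a := b) refl (σ k f) _)) refl
      (tends-+ (tends-shift k (SumsTo⇒Tends Σf)) (tends-const (- σ k f))))

-- Markov property and return time of the chain started at `i`

module ChainLaw ⦃ R : CompleteOrderedField ⦄ {S : Set} (code : S ↣ ℕ) (P : S → S → Theory.ℝ ⦃ R ⦄)
                (stochastic : Theory.IsStochastic ⦃ R ⦄ P) (𝒳 : Theory.MarkovChain ⦃ R ⦄ P) (i : S) where
  open Theory ⦃ R ⦄ hiding (zero; ℙ; law; T; ReturnsAfter; PositiveRecurrent; 𝔼T; Γ-term; Γ)
  open RealLine ⦃ R ⦄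
  open Summation ⦃ R ⦄
  open Infimum ⦃ R ⦄
  open Tail ⦃ R ⦄
  open FirstPassage ⦃ R ⦄ P stochastic i
  open MarkovChain 𝒳
  open SigmaAlgebra F
  open ProbabilityMeasure (law i)
  open Measurability ⦃ R ⦄ F
  open Measure ⦃ R ⦄ (law i)

  -- Events of the past up to time `n`, described through paths in place of a filtration.
  Determined : ℕ → Pred Ω 0ℓ → Set
  Determined n B = ∀ {ω ω′} → (∀ r → r ℕ.≤ n → X r ω ≡ X r ω′) → B ω → B ω′

  module _ (n : ℕ) {B : Pred Ω 0ℓ} (mB : Measurable B) (determined : Determined n B) where
    private
      -- Interpolates in `s` between a whole prescribed trajectory, which is what `markov`
      -- conditions on, and a prescribed state at time `n` alone.
      K : ℕ → (ℕ → S) → Pred Ω 0ℓ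
      K s x ω = B ω × (∀ r → s ℕ.≤ r → r ℕ.≤ n → X r ω ≡ x r)

      mK : ∀ s x → Measurable (K s x)
      mK s x = measurable-∩ mB (measurable-⋂ λ r → measurable-⇒ (s ℕ.≤ r) (measurable-⇒ (r ℕ.≤ n) (measurable r (x r))))

      Next : S → Pred Ω 0ℓ
      Next y ω = X (suc n) ω ≡ y

      override : (ℕ → S) → ℕ → S → ℕ → S
      override x s v r with r ℕ.≟ s
      ... | yes _ = v
      ... | no  _ = x r

      override-≡ : ∀ x s v → override x s v s ≡ v
      override-≡ x s v with s ℕ.≟ s
      ... | yes _  = ≡.refl
      ... | no s≢s = ⊥-elim (s≢s ≡.refl)

      override-> : ∀ x s v {r} → s ℕ.< r → override x s v r ≡ x r
      override-> x s v {r} s<r with r ℕ.≟ s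
      ... | yes ≡.refl = ⊥-elim (ℕ.<-irrefl ≡.refl s<r)
      ... | no _       = ≡.refl

      K-override : ∀ s x v → s ℕ.≤ n → K s (override x s v) ≐ (λ ω → K (suc s) x ω × X s ω ≡ v)
      K-override s x v s≤n =
          (λ (b , h) → (b , λ r s<r r≤n → ≡.trans (h r (ℕ.<⇒≤ s<r) r≤n) (override-> x s v s<r))
                     , ≡.trans (h s ℕ.≤-refl s≤n) (override-≡ x s v))
        , (λ ((b , h) , eq) → b , λ r s≤r r≤n → case ℕ.m≤n⇒m<n∨m≡n s≤r of λ
            { (inj₁ s<r)    → ≡.trans (h r s<r r≤n) (≡.sym (override-> x s v s<r))
            ; (inj₂ ≡.refl) → ≡.trans eq (≡.sym (override-≡ x s v)) })

      -- A whole trajectory decides `B`, so `K 0 x` is either empty or equal to `Follows n x`. Where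
      -- the latter is null, conditioning says nothing, but both sides are 0.
      full : ∀ x y → ℙ (K 0 x ∩ Next y) ≈ ℙ (K 0 x) * P (x n) y
      full x y = by-cases (lem (∃ (K 0 x)))
        where
        mNext = measurable (suc n) y
        by-cases : Dec (∃ (K 0 x)) → ℙ (K 0 x ∩ Next y) ≈ ℙ (K 0 x) * P (x n) y
        by-cases (no ∄ω) = trans (ℙ-empty (measurable-∩ (mK 0 x) mNext) λ ω (k , _) → ∄ω (ω , k))
          (sym (trans (*-congʳ (ℙ-empty (mK 0 x) λ ω k → ∄ω (ω , k))) (zeroˡ _)))
        by-cases (yes (_ , b₀ , h₀)) = nonnull (lem (ℙ (Follows n x) ≈ 0#))
          where
          K≐ : K 0 x ≐ Follows n x
          K≐ = (λ (_ , h) r r≤n → h r z≤n r≤n)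
             , (λ h → determined (λ r r≤n → ≡.trans (h₀ r z≤n r≤n) (≡.sym (h r r≤n))) b₀ , λ r _ → h r)

          ℙK≈ : ℙ (K 0 x) ≈ ℙ (Follows n x)
          ℙK≈ = ℙ-cong (mK 0 x) K≐

          nonnull : Dec (ℙ (Follows n x) ≈ 0#) → ℙ (K 0 x ∩ Next y) ≈ ℙ (K 0 x) * P (x n) y
          nonnull (yes null) = trans
            (≤-antisym (≤-trans (ℙ-mono (measurable-∩ (mK 0 x) mNext) (mK 0 x) proj₁) (≤-reflexive (trans ℙK≈ null)))
                       (ℙ-nonneg (measurable-∩ (mK 0 x) mNext)))
            (sym (trans (*-congʳ (trans ℙK≈ null)) (zeroˡ _)))
          nonnull (no ≉0) = begin
            ℙ (K 0 x ∩ Next y)                              ≈⟨ ℙ-cong (measurable-∩ (mK 0 x) mNext)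
                                                                 ((λ (k , e) → e , proj₁ K≐ k) , (λ (e , f) → proj₂ K≐ f , e)) ⟩
            ℙ (Next y ∩ Follows n x)                        ≈⟨ trans (*-congˡ (⁻¹-inverseˡ _ ≉0)) (*-identityʳ _) ⟨
            ℙ (Next y ∩ Follows n x) * (p ⁻¹ * p)           ≈⟨ *-assoc _ _ _ ⟨
            ℙ (Next y ∩ Follows n x) * p ⁻¹ * p             ≈⟨ *-congʳ (markov i n x y ≉0) ⟩
            P (x n) y * p                                   ≈⟨ *-comm _ _ ⟩
            p * P (x n) y                                   ≈⟨ *-congʳ ℙK≈ ⟨
            ℙ (K 0 x) * P (x n) y                           ∎
            where
            open ≈-Reasoning
            p = ℙ (Follows n x)

      -- Summing out the states one at a time, earliest first.
      partial : ∀ s → s ℕ.≤ n → ∀ x y → ℙ (K s x ∩ Next y) ≈ ℙ (K s x) * P (x n) y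
      partial zero    _   x y = full x y
      partial (suc s) s<n x y = sumsTo-unique
        (ℙ-by-value code (measurable s) (measurable-∩ (mK (suc s) x) mNext))
        (sumsTo-cong term (*-comm _ _) (sumsTo-* (IsStochastic.nonneg stochastic (x n) y)
          (ℙ-by-value code (measurable s) (mK (suc s) x))))
        where
        open ≈-Reasoning
        mNext = measurable (suc n) y
        s≤n = ℕ.<⇒≤ s<n
        term : ∀ v → P (x n) y * ℙ (λ ω → K (suc s) x ω × X s ω ≡ v) ≈
                     ℙ (λ ω → (K (suc s) x ∩ Next y) ω × X s ω ≡ v)
        term v = begin
          P (x n) y * ℙ (λ ω → K (suc s) x ω × X s ω ≡ v)
            ≈⟨ *-cong (reflexive (≡.cong (λ l → P l y) (override-> x s v s<n))) (ℙ-cong (mK s _) (K-override s x v s≤n)) ⟨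
          P (override x s v n) y * ℙ (K s (override x s v))
            ≈⟨ *-comm _ _ ⟩
          ℙ (K s (override x s v)) * P (override x s v n) y
            ≈⟨ partial s s≤n (override x s v) y ⟨
          ℙ (K s (override x s v) ∩ Next y)
            ≈⟨ ℙ-cong (measurable-∩ (mK s _) mNext)
                 ( (λ (k , e) → let k′ , eq = proj₁ (K-override s x v s≤n) k in (k′ , e) , eq)
                 , (λ ((k′ , e) , eq) → proj₂ (K-override s x v s≤n) (k′ , eq) , e)) ⟩
          ℙ (λ ω → (K (suc s) x ∩ Next y) ω × X s ω ≡ v) ∎

    -- The summation over earlier states stops at `s = n`, where only the present state is still
    -- prescribed.
    markov-property : ∀ l y → ℙ (λ ω → (B ω × X n ω ≡ l) × X (suc n) ω ≡ y) ≈ ℙ (λ ω → B ω × X n ω ≡ l) * P l y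
    markov-property l y = trans
      (ℙ-cong (measurable-∩ mBl (measurable (suc n) y)) ((λ (k , e) → to k , e) , (λ (k , e) → from k , e)))
      (trans (partial n ℕ.≤-refl (λ _ → l) y) (*-congʳ (ℙ-cong (mK n _) (from , to))))
      where
      mBl : Measurable (λ ω → B ω × X n ω ≡ l)
      mBl = measurable-∩ mB (measurable n l)
      to : ∀ {ω} → B ω × X n ω ≡ l → K n (λ _ → l) ω
      to (b , e) = b , λ r n≤r r≤n → ≡.subst (λ r → X r _ ≡ l) (ℕ.≤-antisym n≤r r≤n) e
      from : ∀ {ω} → K n (λ _ → l) ω → B ω × X n ω ≡ l
      from (b , h) = b , h n ℕ.≤-refl ℕ.≤-refl

  Avoids : ℕ → Pred Ω 0ℓ
  Avoids n ω = ∀ r → 1 ℕ.≤ r → r ℕ.≤ n → X r ω ≢ i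

  measurable-Avoids : ∀ n → Measurable (Avoids n)
  measurable-Avoids n = measurable-⋂ λ r →
    measurable-⇒ (1 ℕ.≤ r) (measurable-⇒ (r ℕ.≤ n) (complement (measurable r i)))

  Avoids-determined : ∀ n → Determined n (Avoids n)
  Avoids-determined n eq av r 1≤r r≤n e = av r 1≤r r≤n (≡.trans (eq r r≤n) e)

  Avoids-suc : ∀ {n ω} → Avoids (suc n) ω → Avoids n ω
  Avoids-suc av r 1≤r r≤n = av r 1≤r (ℕ.m≤n⇒m≤1+n r≤n)

  ReturnsAfter≐Avoids : ∀ n → ReturnsAfter i n ≐ Avoids n
  ReturnsAfter≐Avoids n = (λ lt r 1≤r r≤n e → <inf⇒∉ lt r≤n (1≤r , e))
                        , (λ av → ∉⇒<inf λ { m≤n (1≤m , e) → av _ 1≤m m≤n e })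

  r : ℕ → ℝ
  r n = ℙ (Avoids n)

  -- The taboo probabilities of the chain, with `i` forbidden after time 0.
  a : ℕ → S → ℝ
  a n q = ℙ (λ ω → Avoids n ω × X n ω ≡ q)

  measurable-a : ∀ n q → Measurable (λ ω → Avoids n ω × X n ω ≡ q)
  measurable-a n q = measurable-∩ (measurable-Avoids n) (measurable n q)

  a-nonneg : ∀ n q → 0# ≤ a n q
  a-nonneg n q = ℙ-nonneg (measurable-a n q)

  a-suc-i : ∀ n → a (suc n) i ≈ 0#
  a-suc-i n = ℙ-empty (measurable-a (suc n) i) λ ω (av , e) → av (suc n) (ℕ.s≤s z≤n) ℕ.≤-refl e

  -- Arriving at `q ≢ i` prolongs the avoidance by one time, so it is enough to require avoidance up
  -- to `n`; this event is split by the state at time `n`.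
  a-suc : ∀ n {q} → q ≢ i → SumsTo (λ l → a n l * P l q) (a (suc n) q)
  a-suc n {q} q≢i = sumsTo-cong
    (λ l → trans (ℙ-cong (measurable-∩ mAq (measurable n l))
                   ((λ ((av , e) , e′) → (av , e′) , e) , (λ ((av , e′) , e) → (av , e) , e′)))
                 (markov-property n (measurable-Avoids n) (Avoids-determined n) l q))
    (ℙ-cong mAq ((λ (av , e) → extend av e , e) , (λ (av , e) → Avoids-suc av , e)))
    (ℙ-by-value code (measurable n) mAq)
    where
    mAq : Measurable (λ ω → Avoids n ω × X (suc n) ω ≡ q)
    mAq = measurable-∩ (measurable-Avoids n) (measurable (suc n) q)

    extend : ∀ {ω} → Avoids n ω → X (suc n) ω ≡ q → Avoids (suc n) ω
    extend av e t 1≤t t≤ with ℕ.m≤n⇒m<n∨m≡n t≤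
    ... | inj₁ t<     = av t 1≤t (ℕ.s≤s⁻¹ t<)
    ... | inj₂ ≡.refl = λ e′ → q≢i (≡.trans (≡.sym e) e′)

  a-zero-i : a 0 i ≈ 1#
  a-zero-i = trans (ℙ-cong (measurable-a 0 i) (proj₂ , λ e → (λ { _ () z≤n }) , e)) (initial i)

  a-zero : ∀ {q} → q ≢ i → a 0 q ≈ 0#
  a-zero {q} q≢i = ≤-antisym (≤-trans (ℙ-mono (measurable-a 0 q) (measurable-∩ universe (complement (measurable 0 i)))
      λ (_ , e) → tt , λ e′ → q≢i (≡.trans (≡.sym e) e′))
    (≤-reflexive (trans (ℙ-∖ (measurable 0 i) universe λ _ → tt)
      (trans (+-cong ℙ-total (-‿cong (initial i))) (-‿inverseʳ 1#))))) (a-nonneg 0 q)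

  -- Induction on `n` that trades one step between the factors: the backward recursion of `g` is
  -- exchanged for the forward equation of `a`. At `q = i` both the weight `off` and the taboo
  -- probability vanish.
  taboo : ∀ n m → SumsTo (λ q → a n q * g m q) (g (n ℕ.+ m) i)
  taboo zero m = sumsTo-cong (λ _ → refl)
    (trans (+-identityʳ _) (trans (*-congʳ a-zero-i) (*-identityˡ _)))
    (sumsTo-support (λ q → *-nonneg (a-nonneg 0 q) (proj₁ (g-bounded m q))) {i ∷ []} (All.[] ∷ []) supp)
    where
    supp : ∀ q → _ ⊎ a 0 q * g m q ≈ 0#
    supp q with lem (q ≡ i)
    ... | yes q≡i = inj₁ (here q≡i)
    ... | no  q≢i = inj₂ (trans (*-congʳ (a-zero q≢i)) (zeroˡ _))
  taboo (suc n) m = tonelli {f = λ l q → a n l * (P l q * (off q * g m q))}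
    (λ l → sumsTo-* (a-nonneg n l) (g-suc m l))
    (λ q → column q (lem (q ≡ i)))
    (≡.subst (λ k → SumsTo (λ l → a n l * g (suc m) l) (g k i)) (ℕ.+-suc n m) (taboo n (suc m)))
    where
    column : ∀ q → Dec (q ≡ i) → SumsTo (λ l → a n l * (P l q * (off q * g m q))) (a (suc n) q * g m q)
    column q (yes ≡.refl) = sumsTo-cong
      (λ l → sym (trans (*-congˡ (*-congˡ (*-congʳ (indicator-false λ i≢i → i≢i ≡.refl))))
                        (solve 3 (λ a p g → a :* (p :* (con ℤ.0ℤ :* g)) := con ℤ.0ℤ) refl (a n l) (P l i) (g m i))))
      (sym (trans (*-congʳ (a-suc-i n)) (zeroˡ _))) sumsTo-0
    column q (no q≢i) = sumsTo-cong
      (λ l → trans (solve 3 (λ a p g → g :* (a :* p) := a :* (p :* (con ℤ.1ℤ :* g))) refl (a n l) (P l q) (g m q))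
                   (*-congˡ (*-congˡ (*-congʳ (sym (indicator-true q≢i))))))
      (*-comm _ _) (sumsTo-* (proj₁ (g-bounded m q)) (a-suc n q≢i))

  r≈g : ∀ n → r n ≈ g n i
  r≈g n = sumsTo-unique (ℙ-by-value code (measurable n) (measurable-Avoids n))
    (sumsTo-cong (λ q → *-identityʳ (a n q)) (reflexive (≡.cong (λ k → g k i) (ℕ.+-identityʳ n))) (taboo n 0))

  r-nonneg : ∀ n → 0# ≤ r n
  r-nonneg n = ℙ-nonneg (measurable-Avoids n)

  r-decreasing : ∀ n → r (suc n) ≤ r n
  r-decreasing n = ℙ-mono (measurable-Avoids (suc n)) (measurable-Avoids n) Avoids-suc

  Returns-at-suc : ∀ n → Avoids n ∩ ∁ (Avoids (suc n)) ≐ (λ ω → T i ω ≡ [ suc n ])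
  Returns-at-suc n =
      (λ (av , ¬av) → ⇒finite (proj₂ (ReturnsAfter≐Avoids n) av) (¬av ∘ proj₁ (ReturnsAfter≐Avoids (suc n))))
    , (λ e → let lt , ≮ = finite⇒ e in
         proj₁ (ReturnsAfter≐Avoids n) lt , ≮ ∘ proj₂ (ReturnsAfter≐Avoids (suc n)))

  measurable-∖ : ∀ n → Measurable (Avoids n ∩ ∁ (Avoids (suc n)))
  measurable-∖ n = measurable-∩ (measurable-Avoids n) (complement (measurable-Avoids (suc n)))

  T≢0 : ∀ ω → T i ω ≢ [ 0 ]
  T≢0 ω e = case ≡.subst ([ 0 ] <⁺_) e (proj₂ (ReturnsAfter≐Avoids 0) {ω} λ { _ () z≤n }) of λ { [ () ] }

  measurable-T : ∀ n → Measurable (λ ω → T i ω ≡ [ n ])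
  measurable-T zero    = resp (⊥-elim , λ {ω} e → T≢0 ω e) (measurable-const ⊥)
  measurable-T (suc n) = resp (Returns-at-suc n) (measurable-∖ n)

  ℙ-T-suc : ∀ n → ℙ (λ ω → T i ω ≡ [ suc n ]) ≈ r n - r (suc n)
  ℙ-T-suc n = trans (sym (ℙ-cong (measurable-∖ n) (Returns-at-suc n)))
    (ℙ-∖ (measurable-Avoids (suc n)) (measurable-Avoids n) Avoids-suc)

  r0≈1 : r 0 ≈ 1#
  r0≈1 = r≈g 0

  module _ (recurrent : ℙ (λ ω → T i ω ≡ ⊤⁺) ≈ 0#) where

    total-return : SumsTo (λ n → ℙ (λ ω → T i ω ≡ [ n ])) 1#
    total-return = sumsTo-cong (λ _ → refl) (trans (ℙ-∖ m⊤ universe λ _ → tt)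
        (trans (+-cong ℙ-total (-‿cong recurrent)) (solve 0 (con ℤ.1ℤ :- con ℤ.0ℤ := con ℤ.1ℤ) refl)))
      (ℙ-partition ℕ↣ℕ measurable-T disjoint finite (λ e → tt , λ e′ → case ≡.trans (≡.sym e) e′ of λ ()))
      where
      disjoint : ∀ {j k ω} → T i ω ≡ [ j ] → T i ω ≡ [ k ] → j ≡ k
      disjoint e e′ = case ≡.trans (≡.sym e) e′ of λ { ≡.refl → ≡.refl }

      finite : ∀ {ω} → (U ∩ ∁ (λ ω → T i ω ≡ ⊤⁺)) ω → ∃[ n ] T i ω ≡ [ n ]
      finite {ω} (_ , ≢⊤) with T i ω
      ... | [ n ] = n , ≡.refl
      ... | ⊤⁺    = ⊥-elim (≢⊤ ≡.refl)

      m⊤ : Measurable (λ ω → T i ω ≡ ⊤⁺)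
      m⊤ = resp
        ( (λ {ω} h → infinite (T i ω) λ n → proj₂ (ReturnsAfter≐Avoids n) (h n))
        , (λ {ω} e n → proj₁ (ReturnsAfter≐Avoids n) (≡.subst ([ n ] <⁺_) (≡.sym e) [ n ]<⊤⁺)))
        (measurable-⋂ measurable-Avoids)
        where
        infinite : ∀ t → (∀ n → [ n ] <⁺ t) → t ≡ ⊤⁺
        infinite ⊤⁺    _ = ≡.refl
        infinite [ m ] h = case h m of λ { [ m<m ] → ⊥-elim (ℕ.<-irrefl ≡.refl m<m) }

    -- The probabilities of the values of `T i` telescope to `1# - r n`, and by recurrence their
    -- total is 1.
    r-tends : Tends r 0#
    r-tends = tends-cong (always λ n → trans (+-congˡ (-‿cong (telescope n))) (solve 1 (λ r → con ℤ.1ℤ :- (con ℤ.1ℤ :- r) := r) refl (r n)))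
      (-‿inverseʳ 1#)
      (tends-+ (tends-const 1#) (tends-neg (tends-suc (SumsTo⇒Tends total-return))))
      where
      telescope : ∀ n → σ (suc n) (λ k → ℙ (λ ω → T i ω ≡ [ k ])) ≈ 1# - r n
      telescope zero    = trans (+-identityʳ _) (trans (ℙ-empty (measurable-T 0) T≢0)
        (sym (trans (+-congˡ (-‿cong r0≈1)) (-‿inverseʳ 1#))))
      telescope (suc n) = trans (σ-last (suc n) λ k → ℙ (λ ω → T i ω ≡ [ k ])) (trans (+-cong (telescope n) (ℙ-T-suc n))
        (solve 2 (λ r s → con ℤ.1ℤ :- r :+ (r :- s) := con ℤ.1ℤ :- s) refl (r n) (r (suc n))))

    r-sumsTo : ∀ {m} → SumsTo (𝔼T-term i) m → SumsTo r m
    r-sumsTo = mean-by-tails ℙ-T-suc r-decreasing r-nonneg r-tends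

  module _ (θ : ℕ) where
    private
      Y : Ω → ℕ
      Y ω = truncate θ (T i ω)

      -- The event that the truncated time exceeds `n`, in a form whose measurability is immediate.
      C : ℕ → Pred Ω 0ℓ
      C n ω = n ℕ.< θ × Avoids n ω

      mC : ∀ n → Measurable (C n)
      mC n = measurable-∩ (measurable-const _) (measurable-Avoids n)

      C-suc : ∀ {n ω} → C (suc n) ω → C n ω
      C-suc (n<θ , av) = ℕ.<-trans (ℕ.n<1+n _) n<θ , Avoids-suc av

      C≐ : ∀ n → C n ≐ (λ ω → n ℕ.< Y ω)
      C≐ n = (λ {ω} (n<θ , av) → ⇒<truncate (T i ω) n<θ (proj₂ (ReturnsAfter≐Avoids n) av))
           , (λ {ω} n<Y → let n<θ , lt = <truncate⇒ (T i ω) n<Y in n<θ , proj₁ (ReturnsAfter≐Avoids n) lt)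

      Y-suc : ∀ n → C n ∩ ∁ (C (suc n)) ≐ (λ ω → Y ω ≡ suc n)
      Y-suc n = (λ (c , ¬c) → ℕ.≤-antisym (ℕ.≮⇒≥ (¬c ∘ proj₂ (C≐ (suc n)))) (proj₁ (C≐ n) c))
              , (λ {ω} e → proj₂ (C≐ n) (ℕ.≤-reflexive (≡.sym e))
                         , λ c → ℕ.<-irrefl (≡.sym e) (proj₁ (C≐ (suc n)) c))

    measurable-truncate : ∀ n → Measurable (λ ω → truncate θ (T i ω) ≡ n)
    measurable-truncate zero    = resp
      ((λ ¬c → ℕ.n≤0⇒n≡0 (ℕ.≮⇒≥ (¬c ∘ proj₂ (C≐ 0)))) , (λ e c → ℕ.<-irrefl (≡.sym e) (proj₁ (C≐ 0) c)))
      (complement (mC 0))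
    measurable-truncate (suc n) = resp (Y-suc n) (measurable-∩ (mC n) (complement (mC (suc n))))

    -- The tails of the truncated time agree with `r` before `θ` and vanish from `θ` on, so
    -- summation by parts up to `θ` leaves no boundary term.
    mean-truncate : SumsTo (λ n → fromℕ n * ℙ (λ ω → truncate θ (T i ω) ≡ n)) (σ θ r)
    mean-truncate = sumsTo-cong (λ _ → refl) by-tails
      (sumsTo-σ-support (suc θ) (λ n → *-nonneg (fromℕ-nonneg n) (ℙ-nonneg (measurable-truncate n))) vanishes)
      where
      ℙC-late : ∀ n → θ ℕ.≤ n → ℙ (C n) ≈ 0#
      ℙC-late n θ≤n = ℙ-empty (mC n) λ ω (n<θ , _) → ℕ.<⇒≱ n<θ θ≤n

      vanishes : ∀ n → suc θ ℕ.≤ n → fromℕ n * ℙ (λ ω → Y ω ≡ n) ≈ 0#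
      vanishes (suc n) (ℕ.s≤s θ≤n) = trans (*-congˡ (ℙ-empty (measurable-truncate (suc n)) λ ω e →
        ℕ.<⇒≱ (proj₁ (proj₁ (proj₂ (Y-suc n) e))) θ≤n)) (zeroʳ _)

      by-tails : σ (suc θ) (λ n → fromℕ n * ℙ (λ ω → Y ω ≡ n)) ≈ σ θ r
      by-tails = begin
        σ (suc θ) (λ n → fromℕ n * ℙ (λ ω → Y ω ≡ n))
          ≈⟨ abel (λ n → ℙ (λ ω → Y ω ≡ n)) (λ n → trans (sym (ℙ-cong (measurable-∩ (mC n) (complement (mC (suc n)))) (Y-suc n)))
                               (ℙ-∖ (mC (suc n)) (mC n) C-suc)) θ ⟩
        σ θ (λ n → ℙ (C n)) - fromℕ θ * ℙ (C θ)
          ≈⟨ +-congˡ (-‿cong (*-congˡ (ℙC-late θ ℕ.≤-refl))) ⟩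
        σ θ (λ n → ℙ (C n)) - fromℕ θ * 0#
          ≈⟨ solve 2 (λ s n → s :- n :* con ℤ.0ℤ := s) refl _ (fromℕ θ) ⟩
        σ θ (λ n → ℙ (C n))
          ≈⟨ σ-cong θ (λ n n<θ → ℙ-cong (mC n) (proj₂ , λ av → n<θ , av)) ⟩
        σ θ r ∎
        where open ≈-Reasoning

-- Expectation of the sample average

module SampleAverage ⦃ R : CompleteOrderedField ⦄ {Ω : Set} {F : Theory.SigmaAlgebra ⦃ R ⦄ Ω}
                     {μ : Theory.ProbabilityMeasure ⦃ R ⦄ F} {Y : Ω → ℕ}
                     (Ŷ : Theory.IndependentCopies ⦃ R ⦄ μ Y) where
  open Theory ⦃ R ⦄ hiding (zero; ℙ; 𝔼average)
  open RealLine ⦃ R ⦄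
  open Summation ⦃ R ⦄
  open IndependentCopies Ŷ
  open ProbabilityMeasure μ′
  open SigmaAlgebra F′
  open Measurability ⦃ R ⦄ F′
  open Measure ⦃ R ⦄ μ′
  private module μ = ProbabilityMeasure μ

  -- By linearity the total of the copies has mean `fromℕ N * e`, and the positive factor cancels.
  𝔼average≈ : ∀ {e} → SumsTo (λ n → fromℕ n * μ.ℙ (λ ω → Y ω ≡ n)) e → 𝔼average ≈ e
  𝔼average≈ {e} EY = trans
    (∑-unique (sumsTo-cong
      (λ v → trans (*-congˡ (*-congˡ (ℙ-cong (measurable-∩ universe (measurable-sum measurable v)) (proj₂ , (tt ,_)))))
                   (solve 3 (λ c v p → c :* (v :* p) := v :* c :* p) refl (fromℕ N ⁻¹) (fromℕ v) _))
      refl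
      (sumsTo-* (⁻¹-nonneg (<⇒≤ 0<N)) (mean-sum measurable λ s →
        sumsTo-cong (λ n → *-congˡ (trans (sym (same-law s n))
          (ℙ-cong (measurable s n) ((tt ,_) , proj₂)))) refl EY))))
    (*-cancel-⁻¹ e 0<N)
    where
    0<N : 0# < fromℕ N
    0<N = <-≤-trans (<-respʳ-≈ (sym (+-identityʳ 1#)) 0<1) (fromℕ-mono N-positive)

-- The bias of the truncated return time

module TruncationBias ⦃ R : CompleteOrderedField ⦄ {S : Set} (code : S ↣ ℕ) (P : S → S → Theory.ℝ ⦃ R ⦄)
                      (stochastic : Theory.IsStochastic ⦃ R ⦄ P) (𝒳 : Theory.MarkovChain ⦃ R ⦄ P)
                      (recurrent : Theory.PositiveRecurrent ⦃ R ⦄ 𝒳) (π : S → Theory.ℝ ⦃ R ⦄) (i : S)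
                      (converges : ∀ j → Theory.SeriesConverges ⦃ R ⦄
                        (λ t → Theory._-_ ⦃ R ⦄ (Theory.power ⦃ R ⦄ P t j i) (π i)))
                      (θ : ℕ) (1≤θ : 1 ℕ.≤ θ) where
  open Theory ⦃ R ⦄ hiding (zero; ℙ; law; T; ReturnsAfter; PositiveRecurrent; 𝔼T; Γ-term; Γ; 𝔼average)
  open RealLine ⦃ R ⦄
  open Summation ⦃ R ⦄
  open Tail ⦃ R ⦄
  open FirstPassage ⦃ R ⦄ P stochastic i
  open MarkovChain 𝒳 using (law; ReturnsAfter; 𝔼T; 𝔼T-term; Γ-term; Γ; T; X)
  open ChainLaw ⦃ R ⦄ code P stochastic 𝒳 i
  open ProbabilityMeasure (law i)

  μ : ℝ
  μ = 𝔼T i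

  Σr : SumsTo r μ
  Σr = r-sumsTo (proj₁ (recurrent i)) (HasSum⇒SumsTo
    (λ n → *-nonneg (fromℕ-nonneg n) (ℙ-nonneg (measurable-T n))) (the-spec (HasSum (𝔼T-term i)) (proj₂ (recurrent i))))

  π*μ≈1 : π i * μ ≈ 1#
  π*μ≈1 = π*mean-return π converges (sumsTo-cong r≈g refl Σr)

  -- The mean excess of the return time over the threshold.
  ρ : ℝ
  ρ = μ - σ θ r

  Σg : SumsTo (λ m → g (θ ℕ.+ m) i) ρ
  Σg = sumsTo-cong (λ m → r≈g (θ ℕ.+ m)) refl (sumsTo-drop θ Σr)

  -- Each term is at most the corresponding term of `Σg`, by `taboo`; thus the weighted series
  -- converges whether or not the mean hitting time from `q` is finite.
  residual : ∀ q → ∃ (SumsTo λ m → a θ q * g m q)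
  residual q = sumsTo-dominated (λ m → *-nonneg (a-nonneg θ q) (proj₁ (g-bounded m q)))
    (λ m → sumsTo-term-≤ (taboo θ m) q) Σg

  H : S → ℝ
  H q = proj₁ (residual q)

  ΣH : SumsTo H ρ
  ΣH = tonelli (taboo θ) (λ q → proj₂ (residual q)) Σg

  -- This fails at threshold 0, where the value is 1. It is what allows Γ to omit the state `i`.
  aθi≈0 : a θ i ≈ 0#
  aθi≈0 = ≡.subst (λ n → a n i ≈ 0#) (ℕ.m+[n∸m]≡n 1≤θ) (a-suc-i (θ ℕ.∸ 1))

  Hi≈0 : H i ≈ 0#
  Hi≈0 = sumsTo-unique (proj₂ (residual i))
    (sumsTo-cong (λ m → sym (trans (*-congʳ aθi≈0) (zeroˡ _))) refl sumsTo-0)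

  ΣH≢i : SumsTo {[ q ∈ S ∣ q ≢ i ]} (H ∘ value) ρ
  ΣH≢i = sumsTo-restrict value (λ { ≡.refl → ≡.refl }) off-range ΣH
    where
    off-range : ∀ q → ¬ (∃[ q′ ] value {P = _≢ i} q′ ≡ q) → H q ≈ 0#
    off-range q none = by-cases (lem (q ≡ i))
      where
      by-cases : Dec (q ≡ i) → H q ≈ 0#
      by-cases (yes ≡.refl) = Hi≈0
      by-cases (no q≢i)     = ⊥-elim (none ((q Refinement., Irrelevant.[ q≢i ]) , ≡.refl))

  p : ℝ
  p = ℙ (ReturnsAfter i θ)

  rθ≈p : r θ ≈ p
  rθ≈p = ℙ-cong (measurable-Avoids θ) (proj₂ (ReturnsAfter≐Avoids θ) , proj₁ (ReturnsAfter≐Avoids θ))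

  Γ-term≈ : ∀ q → p ⁻¹ * π i * H (value q) ≈ Γ-term π i θ q
  Γ-term≈ (q Refinement., Irrelevant.[ q≢i ]) = begin
    p ⁻¹ * π i * H q                         ≈⟨ *-assoc _ _ _ ⟩
    -- The index type stores `q ≢ i` irrelevantly; `recompute` recovers a usable proof through
    -- `lem`.
    p ⁻¹ * (π i * H q)                       ≈⟨ *-congˡ (π*mean-hit π converges (a-nonneg θ q) (recompute (lem (q ≢ i)) q≢i) (proj₂ (residual q))) ⟨
    p ⁻¹ * (a θ q * (Z P π i i - Z P π q i)) ≈⟨ *-assoc _ _ _ ⟨
    p ⁻¹ * a θ q * (Z P π i i - Z P π q i)   ≈⟨ *-congʳ (*-comm _ _) ⟩
    a θ q * p ⁻¹ * (Z P π i i - Z P π q i)   ≈⟨ *-congʳ (*-congʳ (ℙ-cong (measurable-a θ q)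
      ( (λ (av , e) → e , proj₂ (ReturnsAfter≐Avoids θ) av) , (λ (e , lt) → proj₁ (ReturnsAfter≐Avoids θ) lt , e)))) ⟩
    Γ-term π i θ (q Refinement., Irrelevant.[ q≢i ])               ∎
    where open ≈-Reasoning

  0≤π : 0# ≤ π i
  0≤π = tends-≥ (u-tends π converges) (λ t → proj₁ (power-bounded t i i))

  0≤p : 0# ≤ p
  0≤p = ≤-resp refl rθ≈p (r-nonneg θ)

  -- The terms of Γ inherit nonnegativity from `H`, which is not visible from the differences of
  -- `Z`; hence their sum converges unconditionally.
  ΣΓ : SumsTo (Γ-term π i θ) (p ⁻¹ * π i * ρ)
  ΣΓ = sumsTo-cong Γ-term≈ refl (sumsTo-* (*-nonneg (⁻¹-nonneg 0≤p) 0≤π) ΣH≢i)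

  p*Γ≈ : p * Γ π i θ ≈ π i * ρ
  p*Γ≈ = trans (*-congˡ (∑-unique ΣΓ)) (by-cases 0≤p)
    where
    r-late : ∀ m → r (θ ℕ.+ m) ≤ r θ
    r-late zero    = ≤-reflexive (reflexive (≡.cong r (ℕ.+-identityʳ θ)))
    r-late (suc m) = ≤-trans (≤-resp (reflexive (≡.cong r (≡.sym (ℕ.+-suc θ m)))) refl (r-decreasing (θ ℕ.+ m))) (r-late m)

    by-cases : 0# ≤ p → p * (p ⁻¹ * π i * ρ) ≈ π i * ρ
    by-cases (inj₁ 0<p) = trans (*-congˡ (*-assoc _ _ _)) (*-cancel-⁻¹′ _ 0<p)
    -- For a null conditioning event the excess `ρ` vanishes as well, all later tails being at most
    -- `r θ`.
    by-cases (inj₂ 0≈p) = trans (*-congʳ (sym 0≈p)) (trans (zeroˡ _) (sym (trans (*-congˡ ρ≈0) (zeroʳ _))))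
      where
      ρ≈0 : ρ ≈ 0#
      ρ≈0 = sumsTo-unique (sumsTo-drop θ Σr) (sumsTo-cong
        (λ m → ≤-antisym (r-nonneg (θ ℕ.+ m)) (≤-trans (r-late m) (≤-reflexive (trans rθ≈p (sym 0≈p))))) refl sumsTo-0)

  module _ (T̂ : IndependentCopies (law i) (λ ω → truncate θ (T i ω))) where
    -- Kac's formula enters twice: it turns `μ ⁻¹` into `π i`, and it writes `1#` as `π i * μ`.
    bias : 1# - IndependentCopies.𝔼average T̂ ÷ 𝔼T i ≈ p * Γ π i θ
    bias = begin
      1# - Ê * μ ⁻¹             ≈⟨ +-congˡ (-‿cong (*-cong (SampleAverage.𝔼average≈ ⦃ R ⦄ T̂ (mean-truncate θ))
                                                          (⁻¹-unique (trans (*-comm _ _) π*μ≈1)))) ⟩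
      1# - σ θ r * π i          ≈⟨ +-congʳ π*μ≈1 ⟨
      π i * μ - σ θ r * π i     ≈⟨ solve 3 (λ p m s → p :* m :- s :* p := p :* (m :- s)) refl (π i) μ (σ θ r) ⟩
      π i * ρ                   ≈⟨ p*Γ≈ ⟨
      p * Γ π i θ               ∎
      where
      open ≈-Reasoning
      Ê = IndependentCopies.𝔼average T̂

open import Defs
open import Data.Nat.Base using (_^_) renaming (_≤_ to _≤ℕ_)

lemma10 : ⦃ R : CompleteOrderedField ⦄
    {S : Set} → S ↣ ℕ →
    (P : S → S → ℝ) → IsStochastic P →
    (X : MarkovChain P) → Irreducible P → PositiveRecurrent X →
    (π : S → ℝ) → IsStationary P π →
    (i : S) → (∀ j → SeriesConverges (λ t → power P t j i - π i)) →
    (k : ℕ) → 1 ≤ℕ k →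
    (T̂ : IndependentCopies (law X i) (λ ω → truncate (2 ^ k) (T X i ω))) →
    Summable (Γ-term X π i (2 ^ k)) ×
    (1# - 𝔼average T̂ ÷ 𝔼T X i ≈
    ℙ (law X i) (ReturnsAfter X i (2 ^ k)) * Γ X π i (2 ^ k))
lemma10 ⦃ R ⦄ code P stochastic X _ recurrent π _ i converges k _ T̂ =
  (_ , Summation.SumsTo⇒HasSum ⦃ R ⦄ ΣΓ) , bias T̂
  -- Positivity of `2 ^ k` ensures that a path with `T_i > θ` is not at `i` at time `θ`.
  where open TruncationBias ⦃ R ⦄ code P stochastic X recurrent π i converges (2 ^ k) (ℕ.m^n>0 2 k)
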